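{- Let $(S,T)$ be a connected triangulated surface (closed or with boundary) with edges $e_1,\dots,e_m$ and admissible metric space $\Omega_u$, and let $\bar{\mathbf w}=(\bar w_1,\dots,\bar w_m)\in\mathbb{R}^m$. Suppose there exists $\bar{\mathbf u}\in\Omega_u$ whose cotangent edge weights are $\bar{\mathbf w}$, i.e. $w_i(\bar{\mathbf u})=\bar w_i$ for all $i$. Then $\bar{\mathbf u}$ is the unique global minimizer on $\Omega_u$ of the energy $$\mathcal{E}(\mathbf u)=\int_{(1,\dots,1)}^{\mathbf u}\sum_{i=1}^m\big(\bar w_i-w_i(\mu)\big)\,d\mu_i,$$ the integral being taken along any piecewise smooth path in $\Omega_u$.
   Context: Admissible metric space: $\Omega_u=\{u\in\mathbb{R}^m_{>0}: \sum_k u_k=m$, and for every face with edges $e_a,e_b,e_c$, $(\sqrt{u_a},\sqrt{u_b},\sqrt{u_c})$ satisfies the strict triangle inequalities$\}$; $u$ corresponds to the Euclidean polyhedral metric with edge lengths $d_k=\sqrt{2u_k}$. $w_i(u)$ is the cotangent edge weight of $e_i$ in that metric: for an interior edge with opposite angles $\alpha,\beta$ in its two adjacent faces, $w_i=\tfrac12(\cot\alpha+\cot\beta)$; for a boundary edge with opposite angle $\alpha$, $w_i=\tfrac12\cot\alpha$. -}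

module Defs where

open import Level using (0ℓ) renaming (suc to lsuc)
open import Algebra.Bundles using (CommutativeRing)
import Algebra.Properties.Ring as RingProperties
import Algebra.Properties.Monoid.Sum as MonoidSum
import Algebra.Definitions.RawMonoid as RawMonoidDefinitions
open import Data.Bool.Base using (Bool)
open import Data.Fin.Base using (Fin; zero; suc)
open import Data.Nat.Base using (ℕ; NonZero)
open import Data.Product.Base using (∃; ∃₂; _×_; _,_; proj₁; proj₂)
open import Data.Sum.Base using (_⊎_; inj₁; inj₂; [_,_]′)
open import Data.Vec.Functional using (Vector; replicate)
open import Relation.Binary.Construct.Closure.ReflexiveTransitive using (Star; ε; _◅_)
open import Relation.Binary.Core using (Rel)
open import Relation.Binary.PropositionalEquality.Core using (_≡_; _≢_)
open import Relation.Binary.Structures using (IsTotalOrder)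
open import Relation.Nullary.Negation.Core using (¬_)
open import Relation.Unary using (Pred)

-- A complete ordered field, i.e. the real numbers up to isomorphism.  The
-- value of _⁻¹ at 0# is unspecified and is never used.

record CompleteOrderedField : Set (lsuc 0ℓ) where
  infix  8 _⁻¹
  infix  4 _≤_ _<_
  infixl 7 _/_

  field
    commutativeRing : CommutativeRing 0ℓ 0ℓ

  open CommutativeRing commutativeRing public

  field
    1≉0          : ¬ (1# ≈ 0#)
    _⁻¹          : Carrier → Carrier
    *-inverseʳ   : ∀ x → ¬ (x ≈ 0#) → x * x ⁻¹ ≈ 1#
    _≤_          : Rel Carrier 0ℓ
    isTotalOrder : IsTotalOrder _≈_ _≤_
    +-monoˡ-≤    : ∀ {x y} z → x ≤ y → x + z ≤ y + z
    *-nonneg     : ∀ {x y} → 0# ≤ x → 0# ≤ y → 0# ≤ x * y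

  UpperBound : Pred Carrier 0ℓ → Pred Carrier 0ℓ
  UpperBound P b = ∀ x → P x → x ≤ b

  field
    supremum : ∀ (P : Pred Carrier 0ℓ) → ∃ P → ∃ (UpperBound P) →
               ∃ λ s → UpperBound P s × (∀ b → UpperBound P b → s ≤ b)

  open IsTotalOrder isTotalOrder public
    using (total; antisym; ≤-respˡ-≈; ≤-respʳ-≈)
    renaming (refl to ≤-refl; trans to ≤-trans; reflexive to ≤-reflexive)
  open RingProperties ring using (-‿distribˡ-*; -‿distribʳ-*; -‿involutive)
  open MonoidSum +-monoid public using (sum)
  open RawMonoidDefinitions +-rawMonoid public using () renaming (_×_ to _·_)

  _<_ : Rel Carrier 0ℓ
  x < y = x ≤ y × ¬ (x ≈ y)

  _/_ : Carrier → Carrier → Carrier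
  x / y = x * y ⁻¹

  2# : Carrier
  2# = 1# + 1#

  ½ : Carrier
  ½ = 1# / 2#

  ∣_∣ : Carrier → Carrier
  ∣ x ∣ = [ (λ x≤0 → - x) , (λ 0≤x → x) ]′ (total x 0#)

  0≤1 : 0# ≤ 1#
  0≤1 = [ (λ p → p) , (λ 1≤0 → ≤-respʳ-≈ [-1]²≈1 (*-nonneg (0≤-1 1≤0) (0≤-1 1≤0))) ]′ (total 0# 1#)
    where
    0≤-1 : 1# ≤ 0# → 0# ≤ - 1#
    0≤-1 1≤0 = ≤-respʳ-≈ (+-identityˡ _) (≤-respˡ-≈ (-‿inverseʳ 1#) (+-monoˡ-≤ (- 1#) 1≤0))

    [-1]²≈1 : - 1# * - 1# ≈ 1#
    [-1]²≈1 = trans (sym (-‿distribˡ-* 1# (- 1#)))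
                (trans (-‿cong (*-identityˡ (- 1#))) (-‿involutive 1#))

  x≤x*x : ∀ x → 1# ≤ x → x ≤ x * x
  x≤x*x x 1≤x = ≤-respʳ-≈ x[x-1]+x≈x*x (≤-respˡ-≈ (+-identityˡ x)
                  (+-monoˡ-≤ x (*-nonneg (≤-trans 0≤1 1≤x) 0≤x-1)))
    where
    0≤x-1 : 0# ≤ x + - 1#
    0≤x-1 = ≤-respˡ-≈ (-‿inverseʳ 1#) (+-monoˡ-≤ (- 1#) 1≤x)

    x[x-1]+x≈x*x : x * (x + - 1#) + x ≈ x * x
    x[x-1]+x≈x*x =
      trans (+-congˡ (sym (*-identityʳ x)))
        (trans (sym (distribˡ x (x + - 1#) 1#))
          (*-congˡ (trans (+-assoc x (- 1#) 1#)
            (trans (+-congˡ (-‿inverseˡ 1#)) (+-identityʳ x)))))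

  BelowRoot : Carrier → Pred Carrier 0ℓ
  BelowRoot a x = x ≤ 0# ⊎ x * x ≤ a

  belowRoot-bounded : ∀ a → ∃ (UpperBound (BelowRoot a))
  belowRoot-bounded a = [ (λ 1≤a → a , bound a 1≤a ≤-refl) , (λ a≤1 → 1# , bound 1# ≤-refl a≤1) ]′ (total 1# a)
    where
    bound : ∀ b → 1# ≤ b → a ≤ b → UpperBound (BelowRoot a) b
    bound b 1≤b a≤b x (inj₁ x≤0) = ≤-trans x≤0 (≤-trans 0≤1 1≤b)
    bound b 1≤b a≤b x (inj₂ x²≤a) =
      [ (λ x≤1 → ≤-trans x≤1 1≤b) , (λ 1≤x → ≤-trans (x≤x*x x 1≤x) (≤-trans x²≤a a≤b)) ]′ (total x 1#)

  -- The nonnegative square root of a for a ≥ 0 (and 0 for a < 0).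
  √ : Carrier → Carrier
  √ a = proj₁ (supremum (BelowRoot a) (0# , inj₁ ≤-refl) (belowRoot-bounded a))

-- A triangulated compact surface is given by finitely many triangles whose
-- sides are glued in pairs, the unglued sides forming the boundary.  Every
-- such gluing is a surface, so no condition on vertices is needed; simplicial
-- triangulations are the special case in which simplices are determined by
-- their vertices.

next : Fin 3 → Fin 3
next zero             = suc zero
next (suc zero)       = suc (suc zero)
next (suc (suc zero)) = zero

Side : ℕ → Set
Side f = Fin f × Fin 3

-- Corner k of a triangle is opposite to side k, so that side k joins the
-- corners next k and next (next k).  The Boolean says whether the affine
-- identification of the two sides of an interior edge preserves or reverses
-- these directions; it determines S but plays no role for edge weights.

data EdgeType {f m : ℕ} (edge : Side f → Fin m) (i : Fin m) : Set where
  boundary : (s : Side f) → edge s ≡ i →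
             (∀ r → edge r ≡ i → r ≡ s) → EdgeType edge i
  interior : (s t : Side f) → s ≢ t → edge s ≡ i → edge t ≡ i →
             (∀ r → edge r ≡ i → r ≡ s ⊎ r ≡ t) → (gluing : Bool) → EdgeType edge i

record TriangulatedSurface : Set where
  field
    #faces   : ℕ
    nonEmpty : NonZero #faces
    #edges   : ℕ
    edge     : Side #faces → Fin #edges
    edgeType : ∀ i → EdgeType edge i

  Adjacent : Rel (Fin #faces) 0ℓ
  Adjacent f g = ∃₂ λ k l → edge (f , k) ≡ edge (g , l)

-- Faces are glued along edges only, so S is connected iff any two faces are
-- joined by a chain of adjacent ones.
Connected : TriangulatedSurface → Set
Connected T = ∀ f g → Star Adjacent f g
  where open TriangulatedSurface T

module Analysis (ℝ : CompleteOrderedField) where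
  open CompleteOrderedField ℝ

  infix 4 _∈[_,_]

  _∈[_,_] : Carrier → Carrier → Carrier → Set
  t ∈[ a , b ] = a ≤ t × t ≤ b

  ContinuousOn : Carrier → Carrier → (Carrier → Carrier) → Set
  ContinuousOn a b f =
    ∀ t → t ∈[ a , b ] → ∀ η → 0# < η → ∃ λ δ → 0# < δ ×
    (∀ s → s ∈[ a , b ] → ∣ s - t ∣ < δ → ∣ f s - f t ∣ < η)

  -- f′ is the derivative of f on [a, b], one-sided at the endpoints.
  HasDerivativeOn : Carrier → Carrier → (f f′ : Carrier → Carrier) → Set
  HasDerivativeOn a b f f′ =
    ∀ t → t ∈[ a , b ] → ∀ η → 0# < η → ∃ λ δ → 0# < δ ×
    (∀ s → s ∈[ a , b ] → ∣ s - t ∣ < δ →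
       ∣ (f s - f t) - f′ t * (s - t) ∣ ≤ η * ∣ s - t ∣)

  record TaggedInterval (δ a b : Carrier) : Set where
    field
      tag   : Carrier
      a≤tag : a ≤ tag
      tag≤b : tag ≤ b
      mesh  : b - a < δ

  TaggedPartition : (δ a b : Carrier) → Set
  TaggedPartition δ = Star (TaggedInterval δ)

  riemannSum : ∀ {δ a b} → (Carrier → Carrier) → TaggedPartition δ a b → Carrier
  riemannSum f ε = 0#
  riemannSum f (_◅_ {a} {b} I P) = f (TaggedInterval.tag I) * (b - a) + riemannSum f P

  -- The Riemann integral of f over [a, b] exists and equals J.
  HasIntegral : (a b : Carrier) → (Carrier → Carrier) → Carrier → Set
  HasIntegral a b f J =
    ∀ η → 0# < η → ∃ λ δ → 0# < δ ×
    ((P : TaggedPartition δ a b) → ∣ riemannSum f P - J ∣ < η)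

  module _ {m : ℕ} (Ω : Pred (Vector Carrier m) 0ℓ) where

    record SmoothArc (p q : Vector Carrier m) : Set where
      field
        a b          : Carrier
        a<b          : a < b
        γ γ′         : Carrier → Vector Carrier m
        derivative   : ∀ i → HasDerivativeOn a b (λ t → γ t i) (λ t → γ′ t i)
        continuous-′ : ∀ i → ContinuousOn a b (λ t → γ′ t i)
        inside       : ∀ t → t ∈[ a , b ] → Ω (γ t)
        source       : ∀ i → γ a i ≈ p i
        target       : ∀ i → γ b i ≈ q i

    -- A piecewise smooth path, given by its successive C¹ pieces.
    PiecewiseSmoothPath : (p q : Vector Carrier m) → Set
    PiecewiseSmoothPath = Star SmoothArc

  -- The integral of Σᵢ ωᵢ dμᵢ along a path exists and equals J.
  HasLineIntegral : ∀ {m} {Ω : Pred (Vector Carrier m) 0ℓ} {p q} →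
                    (ω : Vector Carrier m → Vector Carrier m) →
                    PiecewiseSmoothPath Ω p q → Carrier → Set
  HasLineIntegral ω ε       J = J ≈ 0#
  HasLineIntegral ω (α ◅ π) J =
    ∃₂ λ K L → HasIntegral a b (λ t → sum λ i → ω (γ t) i * γ′ t i) K ×
               HasLineIntegral ω π L × J ≈ K + L
    where open SmoothArc α

  IsUniqueGlobalMinimizer : ∀ {m} (Ω : Pred (Vector Carrier m) 0ℓ) →
                            (Vector Carrier m → Carrier) → Vector Carrier m → Set
  IsUniqueGlobalMinimizer Ω E ū = IsGlobalMinimizer ū ×
    (∀ u → IsGlobalMinimizer u → ∀ i → u i ≈ ū i)
    where
    IsGlobalMinimizer : Vector Carrier _ → Set
    IsGlobalMinimizer u = Ω u × (∀ v → Ω v → E u ≤ E v)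

module PolyhedralMetric (ℝ : CompleteOrderedField) (T : TriangulatedSurface) where
  open CompleteOrderedField ℝ
  open TriangulatedSurface T
  open Analysis ℝ

  -- Ω_u
  record Admissible (u : Vector Carrier #edges) : Set where
    field
      positive   : ∀ i → 0# < u i
      normalised : sum u ≈ #edges · 1#
      triangle   : ∀ f k → √ (u (edge (f , k))) <
                   √ (u (edge (f , next k))) + √ (u (edge (f , next (next k))))

  length : Vector Carrier #edges → Vector Carrier #edges
  length u i = √ (2# * u i)

  -- Trigonometric ratios of the angle opposite to x in the Euclidean triangle
  -- with side lengths x, y, z: the cosine is given by the law of cosines, and
  -- the sine is positive since the angle lies in (0, π).
  cosAngle sinAngle cotAngle : (x y z : Carrier) → Carrier
  cosAngle x y z = (y * y + z * z - x * x) / (2# * y * z)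
  sinAngle x y z = √ (1# - cosAngle x y z * cosAngle x y z)
  cotAngle x y z = cosAngle x y z / sinAngle x y z

  cotOpposite : Vector Carrier #edges → Side #faces → Carrier
  cotOpposite u (f , k) = cotAngle (d k) (d (next k)) (d (next (next k)))
    where
    d : Fin 3 → Carrier
    d l = length u (edge (f , l))

  weight : Vector Carrier #edges → Vector Carrier #edges
  weight u i with edgeType i
  ... | boundary s _ _         = ½ * cotOpposite u s
  ... | interior s t _ _ _ _ _ = ½ * (cotOpposite u s + cotOpposite u t)

  -- E is the function u ↦ ∫ Σᵢ (w̄ᵢ - wᵢ(μ)) dμᵢ on Ω_u, the integral being
  -- taken from (1,…,1) to u along any piecewise smooth path in Ω_u.  Values of
  -- E outside Ω_u are irrelevant; inside, they are determined because a path
  -- is required to exist.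
  IsEnergy : Vector Carrier #edges → (Vector Carrier #edges → Carrier) → Set
  IsEnergy w̄ E = ∀ u → Admissible u →
    PiecewiseSmoothPath Admissible (replicate #edges 1#) u ×
    ((π : PiecewiseSmoothPath Admissible (replicate #edges 1#) u) →
       HasLineIntegral (λ μ i → w̄ i - weight μ i) π (E u))

{-# OPTIONS --safe #-}

-- The cotangent weights are the gradient of the total area.  Let a, b, c be
-- half the squared side lengths of a face and Q = 4bc - (b + c - a)², so that
-- its area is ½√Q.  The cotangent of the angle opposite to the side of a is
-- (b + c - a)/√Q = ∂√Q/∂a.  Hence E(u) = Σᵢ w̄ᵢ uᵢ - area(u) up to a constant.
--
-- Q is a quadratic form of signature (1, 2), so the reverse Cauchy-Schwarz
-- inequality shows that √Q is concave and lies below its tangent planes, with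
-- equality only along rays.  So E is convex, its critical point ū is a minimum,
-- and any other minimiser is proportional to ū on each face, hence everywhere
-- by connectedness, hence equal to ū by the normalisation.
--
-- Along a C¹ path γ, convexity squeezes the difference quotients of E ∘ γ
-- between those of the tangent planes at both ends of an interval.  This gives
-- strict differentiability without a chain rule, and Cousin's lemma then turns
-- it into convergence of the Riemann sums.  A path from (1,…,1) to u is the
-- segment: there Q = 3(1 - t)² + 2t(1 - t)(a + b + c) + t²Q(a, b, c).

module Submission where

-- Homogeneity carries the argument. Since `√Q` is homogeneous of degree one, its tangent plane at
-- `u` passes through the origin, and Euler's identity reads area(u) = Σᵢ wᵢ(u) uᵢ. Concavity thus
-- becomes area(v) ≤ Σᵢ wᵢ(u) vᵢ, which on each face is the reverse Cauchy-Schwarz inequality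
-- divided by `√Q(u)`. At `ū` the unshifted potential vanishes, and minimality is exactly this
-- inequality. Homogeneity is also why convexity cannot be strict along rays. The triangle
-- inequalities involve roots of the coordinates and are hard to follow along a segment. By Heron's
-- factorisation they amount, for positive `a`, `b`, `c`, to the polynomial condition Q > 0, and all
-- estimates run on that form. The weights are never differentiated: only their continuity is
-- proved, and convexity supplies the rest. Excluded middle turns negated strict inequalities into
-- weak ones, decides `≈`, and finds a point close to a supremum.

open import Defs
open import Level using (0ℓ)
open import Axiom.ExcludedMiddle using (ExcludedMiddle)
open import Data.Product.Base using (∃; _×_; _,_; proj₁; proj₂)
open import Data.Vec.Functional using (Vector; replicate)
open import Algebra.Bundles using (CommutativeRing)
import Algebra.Properties.AbelianGroup as AbelianGroupProperties
import Algebra.Properties.Ring as RingProperties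
import Algebra.Properties.Semiring.Mult.TCOptimised as Mult
import Algebra.Properties.Semiring.Sum as SemiringSum
import Algebra.Solver.Ring as RingSolver
open import Algebra.Solver.Ring.AlmostCommutativeRing using (fromCommutativeRing; _-Raw-AlmostCommutative⟶_)
open import Data.Fin.Base using (Fin; zero; suc)
import Data.Fin.Properties as Fin
open import Data.Integer.Base as ℤ using (ℤ; +_; -[1+_]; +[1+_])
import Data.Integer.Properties as ℤ
open import Data.Maybe.Base using (Maybe; map)
open import Data.Nat.Base as ℕ using (ℕ)
import Data.Nat.Properties as ℕ
import Data.Sign.Base as Sign
open import Data.Sum.Base using (inj₁; inj₂; [_,_]′)
open import Function.Base using (_∘_)
open import Relation.Binary.Construct.Closure.ReflexiveTransitive using (Star; ε; _◅_)
open import Relation.Binary.Core using (Rel)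
open import Relation.Binary.PropositionalEquality.Core as ≡ using (_≡_; _≢_)
import Relation.Binary.Reasoning.Setoid as SetoidReasoning
open import Relation.Nullary.Decidable.Core using (yes; no; dec⇒maybe; decidable-stable)
open import Relation.Nullary.Negation.Core using (¬_; contradiction)

-- A ring solver with integer coefficients

module IntegerSolver (R : CommutativeRing 0ℓ 0ℓ) where
  open CommutativeRing R
  open RingProperties ring
    using (-‿distribˡ-*; -‿distribʳ-*; -‿involutive; -0#≈0#)
  open AbelianGroupProperties +-abelianGroup using (⁻¹-∙-comm)
  open Mult semiring using (×1-homo-*; ×-homo-+; 1+×) renaming (_×_ to _×′_)
  open SetoidReasoning setoid

  private
    -- The optimised multiple makes `0` and `1` denote `0#` and `1#` by computation, so equations
    -- given to `solve` match the goals as they are written.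
    ⟦_⟧ : ℤ → Carrier
    ⟦ + n ⟧      = n ×′ 1#
    ⟦ -[1+ n ] ⟧ = - (ℕ.suc n ×′ 1#)

    -- Integer multiplication is defined through signs and absolute values; its homomorphism law
    -- follows the same decomposition.
    signed : Sign.Sign → Carrier → Carrier
    signed Sign.+ x = x
    signed Sign.- x = - x

    signed-cong : ∀ s {x y} → x ≈ y → signed s x ≈ signed s y
    signed-cong Sign.+ x≈y = x≈y
    signed-cong Sign.- x≈y = -‿cong x≈y

    signed-* : ∀ s t x y → signed (s Sign.* t) (x * y) ≈ signed s x * signed t y
    signed-* Sign.+ Sign.+ x y = refl
    signed-* Sign.+ Sign.- x y = -‿distribʳ-* x y
    signed-* Sign.- Sign.+ x y = -‿distribˡ-* x y
    signed-* Sign.- Sign.- x y = begin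
      x * y         ≈⟨ -‿involutive _ ⟨
      - - (x * y)   ≈⟨ -‿cong (-‿distribʳ-* x y) ⟩
      - (x * - y)   ≈⟨ -‿distribˡ-* x (- y) ⟩
      - x * - y     ∎

    ⟦◃⟧ : ∀ s n → ⟦ s ℤ.◃ n ⟧ ≈ signed s (n ×′ 1#)
    ⟦◃⟧ Sign.+ 0       = refl
    ⟦◃⟧ Sign.- 0       = sym -0#≈0#
    ⟦◃⟧ Sign.+ (ℕ.suc n) = refl
    ⟦◃⟧ Sign.- (ℕ.suc n) = refl

    ⟦sign⟧ : ∀ i → ⟦ i ⟧ ≈ signed (ℤ.sign i) (ℤ.∣ i ∣ ×′ 1#)
    ⟦sign⟧ (+ n)      = refl
    ⟦sign⟧ (-[1+ n ]) = refl

    ⟦*⟧ : ∀ i j → ⟦ i ℤ.* j ⟧ ≈ ⟦ i ⟧ * ⟦ j ⟧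
    ⟦*⟧ i j = begin
      ⟦ i ℤ.* j ⟧
        ≈⟨ ⟦◃⟧ (ℤ.sign i Sign.* ℤ.sign j) (ℤ.∣ i ∣ ℕ.* ℤ.∣ j ∣) ⟩
      signed (ℤ.sign i Sign.* ℤ.sign j) ((ℤ.∣ i ∣ ℕ.* ℤ.∣ j ∣) ×′ 1#)
        ≈⟨ signed-cong (ℤ.sign i Sign.* ℤ.sign j) (×1-homo-* ℤ.∣ i ∣ ℤ.∣ j ∣) ⟩
      signed (ℤ.sign i Sign.* ℤ.sign j) ((ℤ.∣ i ∣ ×′ 1#) * (ℤ.∣ j ∣ ×′ 1#))
        ≈⟨ signed-* (ℤ.sign i) (ℤ.sign j) _ _ ⟩
      signed (ℤ.sign i) (ℤ.∣ i ∣ ×′ 1#) * signed (ℤ.sign j) (ℤ.∣ j ∣ ×′ 1#)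
        ≈⟨ *-cong (⟦sign⟧ i) (⟦sign⟧ j) ⟨
      ⟦ i ⟧ * ⟦ j ⟧ ∎

    ⟦⊖⟧ : ∀ m n → ⟦ m ℤ.⊖ n ⟧ ≈ m ×′ 1# - n ×′ 1#
    ⟦⊖⟧ m       0       = sym (trans (+-congˡ -0#≈0#) (+-identityʳ _))
    ⟦⊖⟧ 0       (ℕ.suc n) = sym (+-identityˡ _)
    ⟦⊖⟧ (ℕ.suc m) (ℕ.suc n) = begin
      ⟦ ℕ.suc m ℤ.⊖ ℕ.suc n ⟧              ≡⟨ ≡.cong ⟦_⟧ (ℤ.[1+m]⊖[1+n]≡m⊖n m n) ⟩
      ⟦ m ℤ.⊖ n ⟧                      ≈⟨ ⟦⊖⟧ m n ⟩
      M - N                            ≈⟨ +-congʳ (+-identityʳ M) ⟨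
      (M + 0#) - N                     ≈⟨ +-congʳ (+-congˡ (-‿inverseʳ 1#)) ⟨
      (M + (1# - 1#)) - N              ≈⟨ +-congʳ (+-assoc M 1# (- 1#)) ⟨
      (M + 1# - 1#) - N                ≈⟨ +-assoc _ _ _ ⟩
      (M + 1#) + (- 1# - N)            ≈⟨ +-cong (+-comm M 1#) (⁻¹-∙-comm 1# N) ⟩
      (1# + M) - (1# + N)              ≈⟨ +-cong (1+× m 1#) (-‿cong (1+× n 1#)) ⟨
      ℕ.suc m ×′ 1# - ℕ.suc n ×′ 1#        ∎
      where
      M = m ×′ 1#
      N = n ×′ 1#

    ⟦+⟧ : ∀ i j → ⟦ i ℤ.+ j ⟧ ≈ ⟦ i ⟧ + ⟦ j ⟧
    ⟦+⟧ (+ m)      (+ n)      = ×-homo-+ 1# m n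
    ⟦+⟧ (+ m)      (-[1+ n ]) = ⟦⊖⟧ m (ℕ.suc n)
    ⟦+⟧ (-[1+ m ]) (+ n)      = trans (⟦⊖⟧ n (ℕ.suc m)) (+-comm _ _)
    ⟦+⟧ (-[1+ m ]) (-[1+ n ]) = begin
      - (ℕ.suc (ℕ.suc (m ℕ.+ n)) ×′ 1#)          ≡⟨ ≡.cong (λ k → - (ℕ.suc k ×′ 1#)) (ℕ.+-suc m n) ⟨
      - ((ℕ.suc m ℕ.+ ℕ.suc n) ×′ 1#)            ≈⟨ -‿cong (×-homo-+ 1# (ℕ.suc m) (ℕ.suc n)) ⟩
      - (ℕ.suc m ×′ 1# + ℕ.suc n ×′ 1#)          ≈⟨ ⁻¹-∙-comm _ _ ⟨
      - (ℕ.suc m ×′ 1#) - ℕ.suc n ×′ 1#          ∎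

    ⟦-⟧ : ∀ i → ⟦ ℤ.- i ⟧ ≈ - ⟦ i ⟧
    ⟦-⟧ (+ 0)      = sym -0#≈0#
    ⟦-⟧ +[1+ n ]   = refl
    ⟦-⟧ (-[1+ n ]) = sym (-‿involutive _)

    morphism : ℤ.+-*-rawRing -Raw-AlmostCommutative⟶ fromCommutativeRing R
    morphism = record
      { ⟦_⟧    = ⟦_⟧
      ; +-homo = ⟦+⟧
      ; *-homo = ⟦*⟧
      ; -‿homo = ⟦-⟧
      ; 0-homo = refl
      ; 1-homo = refl
      }

    -- Equality of integer coefficients is decidable, which lets normal forms drop cancelled terms
    -- by computation.
    _coeff≟_ : ∀ i j → Maybe (⟦ i ⟧ ≈ ⟦ j ⟧)
    i coeff≟ j = map (λ i≡j → reflexive (≡.cong ⟦_⟧ i≡j)) (dec⇒maybe (i ℤ.≟ j))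

  open RingSolver ℤ.+-*-rawRing (fromCommutativeRing R) morphism _coeff≟_
    public using (Polynomial; solve; _:=_; _:+_; _:*_; _:-_; :-_; con)

  :0 :1 :2 : ∀ {n} → Polynomial n
  :0 = con (+ 0)
  :1 = con (+ 1)
  :2 = :1 :+ :1

-- Order, absolute value and square roots

module OrderedField (em : ExcludedMiddle 0ℓ) (ℝ : CompleteOrderedField) where
  open CompleteOrderedField ℝ
  open IntegerSolver commutativeRing public
  open SetoidReasoning setoid

  _≉0 : Carrier → Set
  x ≉0 = ¬ (x ≈ 0#)

  abstract
    -- The form in which most inequalities below are derived: a nonnegative certificate `d`,
    -- together with an identity that recognises it as the difference.
    ≤-by : ∀ {x y d} → 0# ≤ d → d ≈ y - x → x ≤ y
    ≤-by {x} {y} {d} 0≤d d≈y-x =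
      ≤-respʳ-≈ (trans (+-congʳ d≈y-x) (solve 2 (λ x y → y :- x :+ x := y) refl x y))
        (≤-respˡ-≈ (+-identityˡ x) (+-monoˡ-≤ x 0≤d))

    x≤y⇒0≤y-x : ∀ {x y} → x ≤ y → 0# ≤ y - x
    x≤y⇒0≤y-x {x} x≤y = ≤-respˡ-≈ (-‿inverseʳ x) (+-monoˡ-≤ (- x) x≤y)

    x-y≤0⇒x≤y : ∀ {x y} → x - y ≤ 0# → x ≤ y
    x-y≤0⇒x≤y {x} {y} x-y≤0 = ≤-by (x≤y⇒0≤y-x x-y≤0)
      (solve 2 (λ x y → :0 :- (x :- y) := y :- x) refl x y)

    +-mono-≤ : ∀ {x y z w} → x ≤ y → z ≤ w → x + z ≤ y + w
    +-mono-≤ {x} {y} {z} {w} x≤y z≤w = ≤-trans (+-monoˡ-≤ z x≤y)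
      (≤-respˡ-≈ (+-comm z y) (≤-respʳ-≈ (+-comm w y) (+-monoˡ-≤ y z≤w)))

    0≤+ : ∀ {x y} → 0# ≤ x → 0# ≤ y → 0# ≤ x + y
    0≤+ 0≤x 0≤y = ≤-respˡ-≈ (+-identityˡ 0#) (+-mono-≤ 0≤x 0≤y)

    -‿anti-≤ : ∀ {x y} → x ≤ y → - y ≤ - x
    -‿anti-≤ {x} {y} x≤y = ≤-by (x≤y⇒0≤y-x x≤y)
      (solve 2 (λ x y → y :- x := :- x :- :- y) refl x y)

    ≤-<-trans : ∀ {x y z} → x ≤ y → y < z → x < z
    ≤-<-trans x≤y (y≤z , y≉z) =
      ≤-trans x≤y y≤z , λ x≈z → y≉z (antisym y≤z (≤-respˡ-≈ x≈z x≤y))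

    <-≤-trans : ∀ {x y z} → x < y → y ≤ z → x < z
    <-≤-trans (x≤y , x≉y) y≤z =
      ≤-trans x≤y y≤z , λ x≈z → x≉y (antisym x≤y (≤-respʳ-≈ (sym x≈z) y≤z))

    <-respʳ-≈ : ∀ {x y z} → y ≈ z → x < y → x < z
    <-respʳ-≈ y≈z x<y = <-≤-trans x<y (≤-reflexive y≈z)

    <-respˡ-≈ : ∀ {x y z} → y ≈ z → y < x → z < x
    <-respˡ-≈ y≈z y<x = ≤-<-trans (≤-reflexive (sym y≈z)) y<x

    <⇒≱ : ∀ {x y} → x < y → ¬ (y ≤ x)
    <⇒≱ (x≤y , x≉y) y≤x = x≉y (antisym x≤y y≤x)

    ≰⇒> : ∀ {x y} → ¬ (y ≤ x) → x < y
    ≰⇒> {x} {y} y≰x with total x y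
    ... | inj₁ x≤y = x≤y , λ x≈y → y≰x (≤-reflexive (sym x≈y))
    ... | inj₂ y≤x = contradiction y≤x y≰x

    ≮⇒≥ : ∀ {x y} → ¬ (x < y) → y ≤ x
    ≮⇒≥ x≮y = decidable-stable em λ y≰x → x≮y (≰⇒> y≰x)

    <-by : ∀ {x y d} → 0# < d → d ≈ y - x → x < y
    <-by {x} {y} (0≤d , 0≉d) d≈y-x = ≤-by 0≤d d≈y-x ,
      λ x≈y → 0≉d (sym (trans d≈y-x (trans (+-congʳ (sym x≈y)) (-‿inverseʳ x))))

    x<y⇒0<y-x : ∀ {x y} → x < y → 0# < y - x
    x<y⇒0<y-x {x} {y} x<y = ≰⇒> λ y-x≤0 → <⇒≱ x<y (≤-by (x≤y⇒0≤y-x y-x≤0)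
      (solve 2 (λ x y → :0 :- (y :- x) := x :- y) refl x y))

    0<⇒≉0 : ∀ {x} → 0# < x → x ≉0
    0<⇒≉0 0<x x≈0 = proj₂ 0<x (sym x≈0)

    0<+ : ∀ {x y} → 0# < x → 0# ≤ y → 0# < x + y
    0<+ {x} 0<x 0≤y = <-≤-trans 0<x (≤-by 0≤y (solve 2 (λ x y → y := x :+ y :- x) refl x _))

    *-inverseˡ : ∀ x → x ≉0 → x ⁻¹ * x ≈ 1#
    *-inverseˡ x x≉0 = trans (*-comm _ _) (*-inverseʳ x x≉0)

    *-cancelˡ-≈ : ∀ {c x y} → c ≉0 → c * x ≈ c * y → x ≈ y
    *-cancelˡ-≈ {c} {x} {y} c≉0 cx≈cy = trans (expand x) (trans (*-congˡ cx≈cy) (sym (expand y)))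
      where
      expand : ∀ z → z ≈ c ⁻¹ * (c * z)
      expand z = trans (sym (*-identityˡ z)) (trans (*-congʳ (sym (*-inverseˡ c c≉0))) (*-assoc _ _ _))

    0<* : ∀ {x y} → 0# < x → 0# < y → 0# < x * y
    0<* {x} 0<x 0<y = *-nonneg (proj₁ 0<x) (proj₁ 0<y) ,
      λ 0≈xy → proj₂ 0<y (*-cancelˡ-≈ (0<⇒≉0 0<x) (trans (zeroʳ x) 0≈xy))

    0≤x*x : ∀ x → 0# ≤ x * x
    0≤x*x x with total 0# x
    ... | inj₁ 0≤x = *-nonneg 0≤x 0≤x
    ... | inj₂ x≤0 = ≤-respʳ-≈ (solve 1 (λ x → (:0 :- x) :* (:0 :- x) := x :* x) refl x)
                       (*-nonneg (x≤y⇒0≤y-x x≤0) (x≤y⇒0≤y-x x≤0))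

    0<1 : 0# < 1#
    0<1 = 0≤1 , λ 0≈1 → 1≉0 (sym 0≈1)

    0<2 : 0# < 2#
    0<2 = 0<+ 0<1 0≤1

    *-monoˡ-≤ : ∀ {c x y} → 0# ≤ c → x ≤ y → c * x ≤ c * y
    *-monoˡ-≤ {c} {x} {y} 0≤c x≤y = ≤-by (*-nonneg 0≤c (x≤y⇒0≤y-x x≤y))
      (solve 3 (λ c x y → c :* (y :- x) := c :* y :- c :* x) refl c x y)

    *-monoʳ-≤ : ∀ {c x y} → 0# ≤ c → x ≤ y → x * c ≤ y * c
    *-monoʳ-≤ {c} {x} {y} 0≤c x≤y =
      ≤-respˡ-≈ (*-comm c x) (≤-respʳ-≈ (*-comm c y) (*-monoˡ-≤ 0≤c x≤y))

    *-cancelˡ-≤ : ∀ {c x y} → 0# < c → c * x ≤ c * y → x ≤ y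
    *-cancelˡ-≤ {c} {x} {y} 0<c cx≤cy with total x y
    ... | inj₁ x≤y = x≤y
    ... | inj₂ y≤x = ≤-reflexive (*-cancelˡ-≈ (0<⇒≉0 0<c) (antisym cx≤cy (*-monoˡ-≤ (proj₁ 0<c) y≤x)))

    0<⁻¹ : ∀ {x} → 0# < x → 0# < x ⁻¹
    0<⁻¹ {x} 0<x = ≰⇒> λ x⁻¹≤0 → <⇒≱ 0<1 (≤-respˡ-≈ (*-inverseʳ x (0<⇒≉0 0<x))
      (≤-respʳ-≈ (zeroʳ x) (*-monoˡ-≤ (proj₁ 0<x) x⁻¹≤0)))

    2*½≈1 : 2# * ½ ≈ 1#
    2*½≈1 = trans (*-congˡ (*-identityˡ _)) (*-inverseʳ 2# (0<⇒≉0 0<2))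

    0<½ : 0# < ½
    0<½ = <-respʳ-≈ (sym (*-identityˡ _)) (0<⁻¹ 0<2)

    ½+½≈1 : ½ + ½ ≈ 1#
    ½+½≈1 = trans (solve 1 (λ h → h :+ h := :2 :* h) refl ½) 2*½≈1

    0<½* : ∀ {x} → 0# < x → 0# < ½ * x
    0<½* = 0<* 0<½

    ½x+½x≈x : ∀ x → ½ * x + ½ * x ≈ x
    ½x+½x≈x x = trans (sym (distribʳ x ½ ½)) (trans (*-congʳ ½+½≈1) (*-identityˡ x))

    ½x<x : ∀ {x} → 0# < x → ½ * x < x
    ½x<x {x} 0<x = <-by (0<½* 0<x) (begin
      ½ * x                         ≈⟨ solve 1 (λ y → y := (y :+ y) :- y) refl (½ * x) ⟩
      (½ * x + ½ * x) - ½ * x       ≈⟨ +-congʳ (½x+½x≈x x) ⟩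
      x - ½ * x                     ∎)

    commonLowerBound : ∀ {x y} → 0# < x → 0# < y → ∃ λ z → 0# < z × z ≤ x × z ≤ y
    commonLowerBound {x} {y} 0<x 0<y with total x y
    ... | inj₁ x≤y = x , 0<x , ≤-refl , x≤y
    ... | inj₂ y≤x = y , 0<y , y≤x , ≤-refl

    x≤∣x∣ : ∀ x → x ≤ ∣ x ∣
    x≤∣x∣ x with total x 0#
    ... | inj₁ x≤0 = ≤-trans x≤0 (≤-by (x≤y⇒0≤y-x x≤0) (solve 1 (λ x → :0 :- x := :- x :- :0) refl x))
    ... | inj₂ _   = ≤-refl

    -x≤∣x∣ : ∀ x → - x ≤ ∣ x ∣
    -x≤∣x∣ x with total x 0#
    ... | inj₁ _   = ≤-refl
    ... | inj₂ 0≤x = ≤-trans (≤-by 0≤x (solve 1 (λ x → x := :0 :- :- x) refl x)) 0≤x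

    ∣x∣≤ : ∀ {x y} → x ≤ y → - x ≤ y → ∣ x ∣ ≤ y
    ∣x∣≤ {x} x≤y -x≤y with total x 0#
    ... | inj₁ _ = -x≤y
    ... | inj₂ _ = x≤y

    ∣x∣< : ∀ {x y} → x < y → - x < y → ∣ x ∣ < y
    ∣x∣< {x} x<y -x<y with total x 0#
    ... | inj₁ _ = -x<y
    ... | inj₂ _ = x<y

    0≤∣x∣ : ∀ x → 0# ≤ ∣ x ∣
    0≤∣x∣ x with total x 0#
    ... | inj₁ x≤0 = ≤-by (x≤y⇒0≤y-x x≤0) (solve 1 (λ x → :0 :- x := :- x :- :0) refl x)
    ... | inj₂ 0≤x = 0≤x

    ∣∣-cong : ∀ {x y} → x ≈ y → ∣ x ∣ ≈ ∣ y ∣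
    ∣∣-cong {x} {y} x≈y = antisym (le x≈y) (le (sym x≈y))
      where
      le : ∀ {x y} → x ≈ y → ∣ x ∣ ≤ ∣ y ∣
      le {x} {y} x≈y = ∣x∣≤ (≤-respˡ-≈ (sym x≈y) (x≤∣x∣ y)) (≤-respˡ-≈ (sym (-‿cong x≈y)) (-x≤∣x∣ y))

    0≤x⇒∣x∣≈x : ∀ {x} → 0# ≤ x → ∣ x ∣ ≈ x
    0≤x⇒∣x∣≈x {x} 0≤x = antisym (∣x∣≤ ≤-refl (≤-by (0≤+ 0≤x 0≤x) (solve 1 (λ x → x :+ x := x :- :- x)
          refl x))) (x≤∣x∣ x)

    ∣-x∣≤∣x∣ : ∀ x → ∣ - x ∣ ≤ ∣ x ∣
    ∣-x∣≤∣x∣ x = ∣x∣≤ (-x≤∣x∣ x) (≤-respˡ-≈ (solve 1 (λ x → x := :- :- x) refl x) (x≤∣x∣ x))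

    ∣x-y∣≤∣y-x∣ : ∀ x y → ∣ x - y ∣ ≤ ∣ y - x ∣
    ∣x-y∣≤∣y-x∣ x y = ≤-respˡ-≈ (∣∣-cong (solve 2 (λ x y → :- (y :- x) := x :- y)
          refl x y)) (∣-x∣≤∣x∣ (y - x))

    ∣x+y∣≤∣x∣+∣y∣ : ∀ x y → ∣ x + y ∣ ≤ ∣ x ∣ + ∣ y ∣
    ∣x+y∣≤∣x∣+∣y∣ x y = ∣x∣≤ (+-mono-≤ (x≤∣x∣ x) (x≤∣x∣ y))
      (≤-respˡ-≈ (solve 2 (λ x y → :- x :+ :- y := :- (x :+ y))
            refl x y) (+-mono-≤ (-x≤∣x∣ x) (-x≤∣x∣ y)))

    -- With `A` and `B` the absolute values, (A - z)(B + y) + (A + z)(B - y) is twice AB - zy and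
    -- all four factors are nonnegative. Taking `z` to be `x` and `- x` covers both signs.
    ∣x*y∣≤∣x∣*∣y∣ : ∀ x y → ∣ x * y ∣ ≤ ∣ x ∣ * ∣ y ∣
    ∣x*y∣≤∣x∣*∣y∣ x y = ∣x∣≤ (upper x (x≤∣x∣ x) (-x≤∣x∣ x))
        (≤-respˡ-≈ (solve 2 (λ x y → :- x :* y := :- (x :* y)) refl x y)
          (upper (- x) (-x≤∣x∣ x) (≤-respˡ-≈ (solve 1 (λ x → x := :- :- x) refl x) (x≤∣x∣ x))))
      where
      upper : ∀ z → z ≤ ∣ x ∣ → - z ≤ ∣ x ∣ → z * y ≤ ∣ x ∣ * ∣ y ∣
      upper z z≤A -z≤A = *-cancelˡ-≤ 0<2 (≤-by
        (0≤+ (*-nonneg (x≤y⇒0≤y-x z≤A) (x≤y⇒0≤y-x (-x≤∣x∣ y)))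
             (*-nonneg (x≤y⇒0≤y-x -z≤A) (x≤y⇒0≤y-x (x≤∣x∣ y))))
        (solve 4 (λ z y A B → (A :- z) :* (B :- :- y) :+ (A :- :- z) :* (B :- y) :=
                              :2 :* (A :* B) :- :2 :* (z :* y)) refl z y ∣ x ∣ ∣ y ∣))

    ∣∣-cancelˡ-≤ : ∀ {c x y} → 0# < c → ∣ c * x ∣ ≤ c * y → ∣ x ∣ ≤ y
    ∣∣-cancelˡ-≤ {c} {x} 0<c cx≤cy = ∣x∣≤
      (*-cancelˡ-≤ 0<c (≤-trans (x≤∣x∣ _) cx≤cy))
      (*-cancelˡ-≤ 0<c (≤-trans (≤-respˡ-≈ (solve 2 (λ c x → :- (c :* x) := c :* :- x)
            refl c x) (-x≤∣x∣ _)) cx≤cy))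

    x*x≤y*y⇒x≤y : ∀ {x y} → 0# ≤ y → x * x ≤ y * y → x ≤ y
    x*x≤y*y⇒x≤y {x} {y} 0≤y xx≤yy = ≮⇒≥ λ y<x → <⇒≱
      (0<* (x<y⇒0<y-x y<x) (0<+ (x<y⇒0<y-x y<x) (0≤+ 0≤y 0≤y)))
      (≤-by (x≤y⇒0≤y-x xx≤yy)
        (solve 2 (λ x y → y :* y :- x :* x := :0 :- (x :- y) :* (x :- y :+ (y :+ y))) refl x y))

    x*x≈y*y⇒x≈y : ∀ {x y} → 0# ≤ x → 0# ≤ y → x * x ≈ y * y → x ≈ y
    x*x≈y*y⇒x≈y 0≤x 0≤y xx≈yy =
      antisym (x*x≤y*y⇒x≤y 0≤y (≤-reflexive xx≈yy)) (x*x≤y*y⇒x≤y 0≤x (≤-reflexive (sym xx≈yy)))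

    x*x≈0⇒x≈0 : ∀ {x} → x * x ≈ 0# → x ≈ 0#
    x*x≈0⇒x≈0 {x} xx≈0 = antisym
      (x*x≤y*y⇒x≤y ≤-refl (≤-reflexive (trans xx≈0 (sym (zeroˡ 0#)))))
      (≤-respʳ-≈ (solve 1 (λ x → :0 :- (:0 :- x) := x) refl x)
        (x≤y⇒0≤y-x (x*x≤y*y⇒x≤y ≤-refl (≤-reflexive (trans
          (solve 1 (λ x → (:0 :- x) :* (:0 :- x) := x :* x) refl x) (trans xx≈0 (sym (zeroˡ 0#))))))))

    0≤x∧y≈0⇒x≈0 : ∀ {x y} → 0# ≤ x → 0# ≤ y → x + y ≈ 0# → x ≈ 0#
    0≤x∧y≈0⇒x≈0 {x} {y} 0≤x 0≤y x+y≈0 = antisym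
      (≤-respʳ-≈ x+y≈0 (≤-by 0≤y (solve 2 (λ x y → y := x :+ y :- x) refl x y))) 0≤x

    √-upper : ∀ a → UpperBound (BelowRoot a) (√ a)
    √-upper a = proj₁ (proj₂ (supremum (BelowRoot a) _ _))

    √-least : ∀ a b → UpperBound (BelowRoot a) b → √ a ≤ b
    √-least a = proj₂ (proj₂ (supremum (BelowRoot a) _ _))

    0≤√ : ∀ a → 0# ≤ √ a
    0≤√ a = √-upper a 0# (inj₁ ≤-refl)

    √-cong : ∀ {a b} → a ≈ b → √ a ≈ √ b
    √-cong a≈b = antisym (le a≈b) (le (sym a≈b))
      where
      le : ∀ {a b} → a ≈ b → √ a ≤ √ b
      le {a} {b} a≈b = √-least a (√ b) λ
        { x (inj₁ x≤0)  → √-upper b x (inj₁ x≤0)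
        ; x (inj₂ xx≤a) → √-upper b x (inj₂ (≤-respʳ-≈ a≈b xx≤a)) }

    -- For η ≤ 1 one has (s + η)² ≤ s² + (2s + 1)η, so the smaller of 1 and (a - s²)/(2s + 1) can
    -- serve as η.
    increase-root : ∀ {a s} → 0# ≤ s → s * s < a → ∃ λ η → 0# < η × (s + η) * (s + η) ≤ a
    increase-root {a} {s} 0≤s s²<a =
      let k = s + s + 1#
          0<k : 0# < k
          0<k = <-respʳ-≈ (+-comm 1# (s + s)) (0<+ 0<1 (0≤+ 0≤s 0≤s))
          η , 0<η , η≤1 , η≤r = commonLowerBound 0<1 (0<* (x<y⇒0<y-x s²<a) (0<⁻¹ 0<k))
          kr≈ : k * ((a - s * s) * k ⁻¹) ≈ a - s * s
          kr≈ = begin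
            k * ((a - s * s) * k ⁻¹)
              ≈⟨ solve 3 (λ k d i → k :* (d :* i) := d :* (k :* i)) refl k (a - s * s) (k ⁻¹) ⟩
            (a - s * s) * (k * k ⁻¹)     ≈⟨ *-congˡ (*-inverseʳ k (0<⇒≉0 0<k)) ⟩
            (a - s * s) * 1#             ≈⟨ *-identityʳ _ ⟩
            a - s * s                    ∎
      in η , 0<η , ≤-by
        (0≤+ (*-nonneg (proj₁ 0<η) (x≤y⇒0≤y-x η≤1))
             (x≤y⇒0≤y-x (≤-respʳ-≈ kr≈ (*-monoˡ-≤ (proj₁ 0<k) η≤r))))
        (solve 3 (λ a s e → e :* (:1 :- e) :+ ((a :- s :* s) :- (s :+ s :+ :1) :* e) :=
                            a :- (s :+ e) :* (s :+ e)) refl a s η)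

    -- The Newton step from s towards the root of a.
    decrease-root : ∀ {a s} → 0# ≤ a → 0# ≤ s → a < s * s → ∃ λ r → 0# ≤ r × r < s × a ≤ r * r
    decrease-root {a} {s} 0≤a 0≤s a<s² =
      let 0<s : 0# < s
          0<s = 0≤s , λ 0≈s → <⇒≱ a<s² (≤-respˡ-≈ (trans (sym (zeroˡ s)) (*-congʳ 0≈s)) 0≤a)
          0<s+s = 0<+ 0<s 0≤s
          c = (s + s) ⁻¹
          r = (s * s + a) * c
          [s+s]c≈1 = *-inverseʳ (s + s) (0<⇒≉0 0<s+s)
      in r , *-nonneg (0≤+ (0≤x*x s) 0≤a) (proj₁ (0<⁻¹ 0<s+s)) ,
      <-by (0<* (x<y⇒0<y-x a<s²) (0<⁻¹ 0<s+s)) (begin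
        (s * s - a) * c
          ≈⟨ solve 3 (λ s a c → (s :* s :- a) :* c := s :* ((s :+ s) :* c) :- (s :* s :+ a) :* c)
                refl s a c ⟩
        s * ((s + s) * c) - r
          ≈⟨ +-congʳ (trans (*-congˡ [s+s]c≈1) (*-identityʳ s)) ⟩
        s - r ∎) ,
      ≤-by (0≤x*x ((s * s - a) * c)) (begin
        ((s * s - a) * c) * ((s * s - a) * c)
          ≈⟨ solve 3 (λ s a c → ((s :* s :- a) :* c) :* ((s :* s :- a) :* c) :=
                ((s :* s :+ a) :* c) :* ((s :* s :+ a) :* c) :- a :* (((s :+ s) :* c) :* ((s :+ s) :* c)))
                      refl s a c ⟩
        r * r - a * (((s + s) * c) * ((s + s) * c))
          ≈⟨ +-congˡ (-‿cong (*-congˡ (trans (*-cong [s+s]c≈1 [s+s]c≈1) (*-identityʳ 1#)))) ⟩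
        r * r - a * 1#
          ≈⟨ +-congˡ (-‿cong (*-identityʳ a)) ⟩
        r * r - a ∎)

    -- If the square of the supremum exceeded `a`, the Newton step would be a smaller upper bound;
    -- if it fell short, a slightly larger number would still belong to `BelowRoot a`.
    √*√≈ : ∀ {a} → 0# ≤ a → √ a * √ a ≈ a
    √*√≈ {a} 0≤a = antisym
      (≮⇒≥ λ a<s² → let r , 0≤r , r<s , a≤r² = decrease-root 0≤a (0≤√ a) a<s² in
        <⇒≱ r<s (√-least a r λ
          { x (inj₁ x≤0)  → ≤-trans x≤0 0≤r
          ; x (inj₂ xx≤a) → x*x≤y*y⇒x≤y 0≤r (≤-trans xx≤a a≤r²) }))
      (≮⇒≥ λ s²<a → let η , 0<η , [s+η]²≤a = increase-root (0≤√ a) s²<a in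
        <⇒≱ 0<η (≤-by (x≤y⇒0≤y-x (√-upper a (√ a + η) (inj₂ [s+η]²≤a)))
          (solve 2 (λ s e → s :- (s :+ e) := :0 :- e) refl (√ a) η)))

    0<√ : ∀ {a} → 0# < a → 0# < √ a
    0<√ {a} 0<a = 0≤√ a , λ 0≈√ → proj₂ 0<a
      (trans (sym (zeroˡ _)) (trans (*-congʳ 0≈√) (√*√≈ (proj₁ 0<a))))

    √-unique : ∀ {a x} → 0# ≤ x → x * x ≈ a → √ a ≈ x
    √-unique {a} {x} 0≤x xx≈a = x*x≈y*y⇒x≈y (0≤√ a) 0≤x
      (trans (√*√≈ (≤-respʳ-≈ xx≈a (0≤x*x x))) (sym xx≈a))

-- Limits, Cousin's lemma and strict differentiability

module Calculus (em : ExcludedMiddle 0ℓ) (ℝ : CompleteOrderedField) where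
  open CompleteOrderedField ℝ hiding (zero)
  open Analysis ℝ
  open OrderedField em ℝ
  open SetoidReasoning setoid

  -- A limit calculus for δ tending to zero, where `B δ i` says that the index `i` has reached stage
  -- δ. It is applied to intervals contracting to a point, where endpoints and tags converge
  -- together. `Null` and `_⟶_` are records, so that the families in them can be inferred.
  module FilterLimits {I : Set} (B : Carrier → I → Set)
    (B-mono : ∀ {δ ε} i → δ ≤ ε → B δ i → B ε i) where

    record Null (X : I → Carrier) : Set where
      constructor mkNull
      field
        bound : ∀ η → 0# < η → ∃ λ δ → 0# < δ × (∀ i → B δ i → ∣ X i ∣ ≤ η)
    open Null public

    infix 4 _⟶_
    record _⟶_ (X : I → Carrier) (ℓ : Carrier) : Set where
      constructor mkTends
      field
        null : Null (λ i → X i - ℓ)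
    open _⟶_ public

    null-≤ : ∀ {X Y} → (∀ i → ∣ X i ∣ ≤ ∣ Y i ∣) → Null Y → Null X
    null-≤ X≤Y nY .bound η 0<η with bound nY η 0<η
    ... | δ , 0<δ , Y≤η = δ , 0<δ , λ i Bi → ≤-trans (X≤Y i) (Y≤η i Bi)

    null-cong : ∀ {X Y} → (∀ i → X i ≈ Y i) → Null X → Null Y
    null-cong X≈Y = null-≤ (λ i → ≤-reflexive (∣∣-cong (sym (X≈Y i))))

    null-+ : ∀ {X Y} → Null X → Null Y → Null (λ i → X i + Y i)
    null-+ {X} {Y} nX nY .bound η 0<η with bound nX (½ * η) (0<½* 0<η) | bound nY (½ * η) (0<½* 0<η)
    ... | δ₁ , 0<δ₁ , X≤ | δ₂ , 0<δ₂ , Y≤ with commonLowerBound 0<δ₁ 0<δ₂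
    ... | δ , 0<δ , δ≤δ₁ , δ≤δ₂ = δ , 0<δ , λ i Bi →
      ≤-trans (∣x+y∣≤∣x∣+∣y∣ (X i) (Y i))
        (≤-respʳ-≈ (½x+½x≈x η) (+-mono-≤ (X≤ i (B-mono i δ≤δ₁ Bi)) (Y≤ i (B-mono i δ≤δ₂ Bi))))

    null-* : ∀ {X Y} → Null X → Null Y → Null (λ i → X i * Y i)
    null-* {X} {Y} nX nY .bound η 0<η with bound nX 1# 0<1 | bound nY η 0<η
    ... | δ₁ , 0<δ₁ , X≤ | δ₂ , 0<δ₂ , Y≤ with commonLowerBound 0<δ₁ 0<δ₂
    ... | δ , 0<δ , δ≤δ₁ , δ≤δ₂ = δ , 0<δ , λ i Bi →
      ≤-trans (∣x*y∣≤∣x∣*∣y∣ (X i) (Y i))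
        (≤-respʳ-≈ (*-identityˡ η)
          (≤-trans (*-monoʳ-≤ (0≤∣x∣ _) (X≤ i (B-mono i δ≤δ₁ Bi))) (*-monoˡ-≤ 0≤1 (Y≤ i (B-mono i δ≤δ₂ Bi)))))

    null-const* : ∀ {X} c → Null X → Null (λ i → c * X i)
    null-const* {X} c nX .bound η 0<η =
      let k = 1# + ∣ c ∣
          0<k : 0# < k
          0<k = 0<+ 0<1 (0≤∣x∣ c)
          0<η/k = 0<* 0<η (0<⁻¹ 0<k)
          δ , 0<δ , X≤ = bound nX (η * k ⁻¹) 0<η/k
      in δ , 0<δ , λ i Bi →
      ≤-trans (∣x*y∣≤∣x∣*∣y∣ c (X i))
        (≤-trans (*-monoˡ-≤ (0≤∣x∣ c) (X≤ i Bi))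
          (≤-respʳ-≈ (begin
            k * (η * k ⁻¹)   ≈⟨ solve 3 (λ k e j → k :* (e :* j) := e :* (k :* j)) refl k η (k ⁻¹) ⟩
            η * (k * k ⁻¹)   ≈⟨ *-congˡ (*-inverseʳ k (0<⇒≉0 0<k)) ⟩
            η * 1#           ≈⟨ *-identityʳ η ⟩
            η                ∎)
            (*-monoʳ-≤ (proj₁ 0<η/k) (≤-by 0≤1 (solve 1 (λ c → :1 := :1 :+ c :- c) refl ∣ c ∣)))))

    null-0 : Null (λ _ → 0#)
    null-0 .bound η 0<η = 1# , 0<1 , λ _ _ → ≤-respˡ-≈ (sym (0≤x⇒∣x∣≈x ≤-refl)) (proj₁ 0<η)

    ⟶-const : ∀ c → (λ _ → c) ⟶ c
    ⟶-const c = mkTends (null-cong (λ _ → sym (-‿inverseʳ c)) null-0)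

    ⟶-cong : ∀ {X Y k ℓ} → (∀ i → X i ≈ Y i) → k ≈ ℓ → X ⟶ k → Y ⟶ ℓ
    ⟶-cong X≈Y k≈ℓ X⟶k = mkTends (null-cong (λ i → +-cong (X≈Y i) (-‿cong k≈ℓ)) (null X⟶k))

    ⟶-+ : ∀ {X Y k ℓ} → X ⟶ k → Y ⟶ ℓ → (λ i → X i + Y i) ⟶ k + ℓ
    ⟶-+ {X} {Y} {k} {ℓ} X⟶k Y⟶ℓ = mkTends (null-cong
      (λ i → solve 4 (λ x y k l → (x :- k) :+ (y :- l) := x :+ y :- (k :+ l)) refl (X i) (Y i) k ℓ)
      (null-+ (null X⟶k) (null Y⟶ℓ)))

    ⟶-* : ∀ {X Y k ℓ} → X ⟶ k → Y ⟶ ℓ → (λ i → X i * Y i) ⟶ k * ℓ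
    ⟶-* {X} {Y} {k} {ℓ} X⟶k Y⟶ℓ = mkTends (null-cong
      (λ i → solve 4 (λ x y k l → (x :- k) :* (y :- l) :+ (k :* (y :- l) :+ l :* (x :- k)) := x :* y :- k :* l)
               refl (X i) (Y i) k ℓ)
      (null-+ (null-* (null X⟶k) (null Y⟶ℓ)) (null-+ (null-const* k (null Y⟶ℓ)) (null-const* ℓ (null X⟶k)))))

    ⟶-neg : ∀ {X ℓ} → X ⟶ ℓ → (λ i → - X i) ⟶ - ℓ
    ⟶-neg {X} {ℓ} X⟶ℓ = mkTends (null-≤
      (λ i → ≤-respˡ-≈ (∣∣-cong (solve 2 (λ x l → :- (x :- l) := :- x :- :- l)
            refl (X i) ℓ)) (∣-x∣≤∣x∣ (X i - ℓ)))
      (null X⟶ℓ))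

    ⟶-- : ∀ {X Y k ℓ} → X ⟶ k → Y ⟶ ℓ → (λ i → X i - Y i) ⟶ k - ℓ
    ⟶-- X⟶k Y⟶ℓ = ⟶-+ X⟶k (⟶-neg Y⟶ℓ)

    ⟶-sum : ∀ {n} {X : Fin n → I → Carrier} {ℓ : Vector Carrier n} →
            (∀ j → X j ⟶ ℓ j) → (λ i → sum λ j → X j i) ⟶ sum ℓ
    ⟶-sum {ℕ.zero}  X⟶ℓ = ⟶-const 0#
    ⟶-sum {ℕ.suc n} X⟶ℓ = ⟶-+ (X⟶ℓ zero) (⟶-sum (λ j → X⟶ℓ (suc j)))

    ⟶-squeeze : ∀ {X Y Z ℓ} → (∀ i → X i ≤ Y i) → (∀ i → Y i ≤ Z i) → X ⟶ ℓ → Z ⟶ ℓ → Y ⟶ ℓ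
    ⟶-squeeze {X} {Y} {Z} {ℓ} X≤Y Y≤Z X⟶ℓ Z⟶ℓ .null .bound η 0<η
      with bound (null X⟶ℓ) η 0<η | bound (null Z⟶ℓ) η 0<η
    ... | δ₁ , 0<δ₁ , X≤ | δ₂ , 0<δ₂ , Z≤ with commonLowerBound 0<δ₁ 0<δ₂
    ... | δ , 0<δ , δ≤δ₁ , δ≤δ₂ = δ , 0<δ , λ i Bi → ∣x∣≤
      (≤-trans (+-monoˡ-≤ (- ℓ) (Y≤Z i)) (≤-trans (x≤∣x∣ _) (Z≤ i (B-mono i δ≤δ₂ Bi))))
      (≤-trans (-‿anti-≤ (+-monoˡ-≤ (- ℓ) (X≤Y i))) (≤-trans (-x≤∣x∣ _) (X≤ i (B-mono i δ≤δ₁ Bi))))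

    -- The difference of the roots is X - ℓ divided by √X + √ℓ, and that denominator is at least √ℓ.
    -- To avoid dividing by it, squares are compared: `d * k` equals (X - ℓ)/√ℓ, where `k` is 1 +
    -- √X/√ℓ and hence `k * k` is at least 1.
    ⟶-√ : ∀ {X ℓ} → (∀ i → 0# < X i) → 0# < ℓ → X ⟶ ℓ → (λ i → √ (X i)) ⟶ √ ℓ
    ⟶-√ {X} {ℓ} 0<X 0<ℓ X⟶ℓ = mkTends (null-≤ bounded (null-const* (√ ℓ ⁻¹) (null X⟶ℓ)))
      where
      l = √ ℓ
      0<l = 0<√ 0<ℓ
      bounded : ∀ i → ∣ √ (X i) - l ∣ ≤ ∣ l ⁻¹ * (X i - ℓ) ∣
      bounded i = x*x≤y*y⇒x≤y (0≤∣x∣ _) (≤-respˡ-≈ (sq≈ (x - l)) (≤-respʳ-≈ (sq≈ (l ⁻¹ * (X i - ℓ)))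
        (≤-respʳ-≈ (begin
            (d * (l ⁻¹ * (x + l))) * (d * (l ⁻¹ * (x + l)))
              ≈⟨ *-cong eq eq ⟩
            (l ⁻¹ * (X i - ℓ)) * (l ⁻¹ * (X i - ℓ)) ∎)
          (≤-by (*-nonneg (0≤x*x d) 0≤k²-1)
            (solve 2 (λ d k → (d :* d) :* (k :* k :- :1) := (d :* k) :* (d :* k) :- d :* d) refl d k)))))
        where
        x = √ (X i)
        d = x - l
        k = l ⁻¹ * (x + l)
        sq≈ : ∀ z → z * z ≈ ∣ z ∣ * ∣ z ∣
        sq≈ z with total z 0#
        ... | inj₁ _ = solve 1 (λ z → z :* z := :- z :* :- z) refl z
        ... | inj₂ _ = refl
        eq : d * k ≈ l ⁻¹ * (X i - ℓ)
        eq = begin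
          (x - l) * (l ⁻¹ * (x + l))
            ≈⟨ solve 3 (λ x l j → (x :- l) :* (j :* (x :+ l)) := j :* (x :* x :- l :* l))
                refl x l (l ⁻¹) ⟩
          l ⁻¹ * (x * x - l * l)      ≈⟨ *-congˡ (+-cong (√*√≈ (proj₁ (0<X i))) (-‿cong (√*√≈ (proj₁ 0<ℓ)))) ⟩
          l ⁻¹ * (X i - ℓ)            ∎
        0≤l⁻¹x = *-nonneg (proj₁ (0<⁻¹ 0<l)) (0≤√ (X i))
        k≈ : k ≈ l ⁻¹ * x + 1#
        k≈ = trans (distribˡ _ _ _) (+-congˡ (*-inverseˡ l (0<⇒≉0 0<l)))
        0≤k²-1 : 0# ≤ k * k - 1#
        0≤k²-1 = ≤-respʳ-≈ (trans (solve 1 (λ y → y :* y :+ (y :+ y) := (y :+ :1) :* (y :+ :1) :- :1)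
              refl (l ⁻¹ * x))
                             (+-congʳ (sym (*-cong k≈ k≈))))
                   (0≤+ (0≤x*x (l ⁻¹ * x)) (0≤+ 0≤l⁻¹x 0≤l⁻¹x))

    -- The bound κ ≤ ½ℓ keeps X above ½ℓ. The bound κ ≤ ½ℓ·ℓη then gives |ℓ - X| ≤ Xℓη, which is the
    -- claim multiplied by Xℓ.
    ⟶-⁻¹ : ∀ {X ℓ} → (∀ i → 0# < X i) → 0# < ℓ → X ⟶ ℓ → (λ i → X i ⁻¹) ⟶ ℓ ⁻¹
    ⟶-⁻¹ {X} {ℓ} 0<X 0<ℓ X⟶ℓ .null .bound η 0<η
      with commonLowerBound (0<½* 0<ℓ) (0<* (0<½* 0<ℓ) (0<* 0<ℓ 0<η))
    ... | κ , 0<κ , κ≤½ℓ , κ≤½ℓℓη with bound (null X⟶ℓ) κ 0<κ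
    ... | δ , 0<δ , X-ℓ≤κ = δ , 0<δ , λ i Bi →
      let x = X i
          ½ℓ≤x : ½ * ℓ ≤ x
          ½ℓ≤x = ≤-by (x≤y⇒0≤y-x (≤-trans (-x≤∣x∣ _) (≤-trans (X-ℓ≤κ i Bi) κ≤½ℓ)))
                   (trans (solve 3 (λ h l x → h :- :- (x :- l) := x :- (l :- h)) refl (½ * ℓ) ℓ x)
                     (+-congˡ (-‿cong (trans (+-congʳ (sym (½x+½x≈x ℓ)))
                       (solve 1 (λ h → h :+ h :- h := h) refl (½ * ℓ))))))
      in ∣∣-cancelˡ-≤ (0<* (0<X i) 0<ℓ)
        (≤-respˡ-≈ (∣∣-cong (begin
            ℓ - x
              ≈⟨ +-cong (*-identityʳ ℓ) (-‿cong (*-identityʳ x)) ⟨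
            ℓ * 1# - x * 1#
              ≈⟨ +-cong (*-congˡ (*-inverseʳ x (0<⇒≉0 (0<X i)))) (-‿cong (*-congˡ (*-inverseʳ ℓ (0<⇒≉0 0<ℓ)))) ⟨
            ℓ * (x * x ⁻¹) - x * (ℓ * ℓ ⁻¹)
              ≈⟨ solve 4 (λ x l j k → l :* (x :* j) :- x :* (l :* k) := (x :* l) :* (j :- k))
                    refl x ℓ (x ⁻¹) (ℓ ⁻¹) ⟩
            (x * ℓ) * (x ⁻¹ - ℓ ⁻¹) ∎))
          (≤-trans (∣x-y∣≤∣y-x∣ ℓ x)
            (≤-trans (X-ℓ≤κ i Bi)
              (≤-trans κ≤½ℓℓη
                (≤-respʳ-≈ (sym (*-assoc x ℓ η)) (*-monoʳ-≤ (proj₁ (0<* 0<ℓ 0<η)) ½ℓ≤x))))))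

  ∣x-y∣<-≤ : ∀ {x y δ} → x ≤ y → y - x < δ → ∣ x - y ∣ < δ
  ∣x-y∣<-≤ {x} {y} x≤y y-x<δ =
    ≤-<-trans (≤-trans (∣x-y∣≤∣y-x∣ x y) (≤-reflexive (0≤x⇒∣x∣≈x (x≤y⇒0≤y-x x≤y)))) y-x<δ

  ∣x-y∣<-≥ : ∀ {x y δ} → y ≤ x → x - y < δ → ∣ x - y ∣ < δ
  ∣x-y∣<-≥ y≤x x-y<δ = <-respˡ-≈ (sym (0≤x⇒∣x∣≈x (x≤y⇒0≤y-x y≤x))) x-y<δ

  abstract
    -- The supremum of all x with P a x is attained and cannot lie below b.
    cousin : (P : Rel Carrier 0ℓ) {a b : Carrier} → a ≤ b →
      (∀ {x y z} → x ≤ y → y ≤ z → P x y → P y z → P x z) →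
      (∀ t → t ∈[ a , b ] → ∃ λ δ → 0# < δ ×
        (∀ x y → a ≤ x → x ≤ t → t ≤ y → y ≤ b → ∣ x - t ∣ < δ → ∣ y - t ∣ < δ → P x y)) →
      P a b
    cousin P {a} {b} a≤b additive local = result
      where
      S : Carrier → Set
      S x = a ≤ x × x ≤ b × P a x

      ∣x-x∣<δ : ∀ {δ} x → 0# < δ → ∣ x - x ∣ < δ
      ∣x-x∣<δ x 0<δ = ∣x-y∣<-≤ ≤-refl (<-respˡ-≈ (sym (-‿inverseʳ x)) 0<δ)

      Sa : S a
      Sa with local a (≤-refl , a≤b)
      ... | δ , 0<δ , near = ≤-refl , a≤b ,
        near a a ≤-refl ≤-refl ≤-refl a≤b (∣x-x∣<δ a 0<δ) (∣x-x∣<δ a 0<δ)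

      result : P a b
      result with supremum S (a , Sa) (b , λ x Sx → proj₁ (proj₂ Sx))
      ... | c , upper , least with local c (upper a Sa , least b λ x Sx → proj₁ (proj₂ Sx))
      ... | δ , 0<δ , near with em {∃ λ x → S x × c - ½ * δ < x}
      ... | no none = contradiction
        (least (c - ½ * δ) λ x Sx → ≮⇒≥ λ c-δ/2<x → none (x , Sx , c-δ/2<x))
        (<⇒≱ (<-by (0<½* 0<δ) (solve 2 (λ c h → h := c :- (c :- h)) refl c (½ * δ))))
      ... | yes (x , Sx@(a≤x , x≤b , Pax) , c-δ/2<x) with total b (c + ½ * δ)
      ...   | inj₁ b≤c+δ/2 = additive a≤x x≤b Pax
          (near x b a≤x (upper x Sx) (least b λ x Sx → proj₁ (proj₂ Sx)) ≤-refl
            (∣x-y∣<-≤ (upper x Sx) (≤-<-trans (≤-by (x≤y⇒0≤y-x (proj₁ c-δ/2<x))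
              (solve 3 (λ x c h → x :- (c :- h) := h :- (c :- x)) refl x c (½ * δ))) (½x<x 0<δ)))
            (∣x-y∣<-≥ (least b λ x Sx → proj₁ (proj₂ Sx)) (≤-<-trans (≤-by (x≤y⇒0≤y-x b≤c+δ/2)
              (solve 3 (λ b c h → c :+ h :- b := h :- (b :- c)) refl b c (½ * δ))) (½x<x 0<δ))))
      ...   | inj₂ c+δ/2≤b = contradiction
          (upper (c + ½ * δ) (≤-trans (upper a Sa) c≤c+δ/2 , c+δ/2≤b , additive a≤x (≤-trans (upper x Sx) c≤c+δ/2) Pax
            (near x (c + ½ * δ) a≤x (upper x Sx) c≤c+δ/2 c+δ/2≤b
            (∣x-y∣<-≤ (upper x Sx) (≤-<-trans (≤-by (x≤y⇒0≤y-x (proj₁ c-δ/2<x))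
              (solve 3 (λ x c h → x :- (c :- h) := h :- (c :- x)) refl x c (½ * δ))) (½x<x 0<δ)))
            (∣x-y∣<-≥ c≤c+δ/2 (<-respˡ-≈ (solve 2 (λ c h → h := c :+ h :- c)
                  refl c (½ * δ)) (½x<x 0<δ))))))
          (<⇒≱ c<c+δ/2)
        where
        c<c+δ/2 : c < c + ½ * δ
        c<c+δ/2 = <-by (0<½* 0<δ) (solve 2 (λ c h → h := c :+ h :- c) refl c (½ * δ))
        c≤c+δ/2 : c ≤ c + ½ * δ
        c≤c+δ/2 = proj₁ c<c+δ/2

  -- A nondegenerate subinterval [q, r] of [a, b] with a tag p.
  record TaggedSubinterval (a b : Carrier) : Set where
    field
      q p r : Carrier
      a≤q   : a ≤ q
      q≤p   : q ≤ p
      p≤r   : p ≤ r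
      r≤b   : r ≤ b
      q<r   : q < r

    q∈ : q ∈[ a , b ]
    q∈ = a≤q , ≤-trans q≤p (≤-trans p≤r r≤b)
    p∈ : p ∈[ a , b ]
    p∈ = ≤-trans a≤q q≤p , ≤-trans p≤r r≤b
    r∈ : r ∈[ a , b ]
    r∈ = ≤-trans a≤q (≤-trans q≤p p≤r) , r≤b

    h : Carrier
    h = r - q
    0<h : 0# < h
    0<h = x<y⇒0<y-x q<r
    h*h⁻¹≈1 : h * h ⁻¹ ≈ 1#
    h*h⁻¹≈1 = *-inverseʳ h (0<⇒≉0 0<h)

  between : ∀ {q p r t δ} → q ≤ p → p ≤ r → ∣ q - t ∣ < δ → ∣ r - t ∣ < δ → ∣ p - t ∣ < δ
  between {t = t} q≤p p≤r ∣q-t∣<δ ∣r-t∣<δ = ∣x∣<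
    (≤-<-trans (≤-trans (+-monoˡ-≤ (- t) p≤r) (x≤∣x∣ _)) ∣r-t∣<δ)
    (≤-<-trans (≤-trans (-‿anti-≤ (+-monoˡ-≤ (- t) q≤p)) (-x≤∣x∣ _)) ∣q-t∣<δ)

  module At (a b t : Carrier) where
    open TaggedSubinterval

    -- Only the endpoints are constrained, and `t` may lie outside the interval: limits of slopes
    -- along this filter are strict derivatives. The tag is then close to `t` by `between`.
    Near : Carrier → TaggedSubinterval a b → Set
    Near δ i = ∣ q i - t ∣ < δ × ∣ r i - t ∣ < δ

    Near-mono : ∀ {δ ε} i → δ ≤ ε → Near δ i → Near ε i
    Near-mono i δ≤ε (q<δ , r<δ) = <-≤-trans q<δ δ≤ε , <-≤-trans r<δ δ≤ε

    open FilterLimits Near Near-mono public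

    module _ {f : Carrier → Carrier} (f-cont : ContinuousOn a b f) (t∈ : t ∈[ a , b ]) where

      continuous-along : (x : TaggedSubinterval a b → Carrier) →
        (∀ i → x i ∈[ a , b ]) → (∀ i {δ} → Near δ i → ∣ x i - t ∣ < δ) →
        (λ i → f (x i)) ⟶ f t
      continuous-along x x∈ x-near .null .bound η 0<η with f-cont t t∈ η 0<η
      ... | δ , 0<δ , close = δ , 0<δ , λ i Ni → proj₁ (close (x i) (x∈ i) (x-near i Ni))

      continuous-q : (λ i → f (q i)) ⟶ f t
      continuous-q = continuous-along q q∈ (λ i → proj₁)
      continuous-p : (λ i → f (p i)) ⟶ f t
      continuous-p = continuous-along p p∈ (λ i Ni → between (q≤p i) (p≤r i) (proj₁ Ni) (proj₂ Ni))
      continuous-r : (λ i → f (r i)) ⟶ f t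
      continuous-r = continuous-along r r∈ (λ i → proj₂)

    slope : (Carrier → Carrier) → TaggedSubinterval a b → Carrier
    slope f i = (f (r i) - f (q i)) * h i ⁻¹

    -- By Cousin's lemma, the deviation of f from linearity on a whole interval
    -- is controlled by the variation of f′ there.
    strictly-differentiable : ∀ {f f′} → HasDerivativeOn a b f f′ → ContinuousOn a b f′ →
      t ∈[ a , b ] → slope f ⟶ f′ t
    strictly-differentiable {f} {f′} f-der f′-cont t∈ .null .bound η 0<η
      with f′-cont t t∈ (½ * η) (0<½* 0<η)
    ... | δ , 0<δ , f′-close = δ , 0<δ , main
      where
      c = f′ t

      P : Rel Carrier 0ℓ
      P x y = ∣ (f y - f x) - c * (y - x) ∣ ≤ η * (y - x)

      additive : ∀ {x y z} → x ≤ y → y ≤ z → P x y → P y z → P x z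
      additive {x} {y} {z} _ _ Pxy Pyz =
        ≤-respˡ-≈ (∣∣-cong (solve 7 (λ x y z X Y Z c →
            (Y :- X) :- c :* (y :- x) :+ ((Z :- Y) :- c :* (z :- y)) := (Z :- X) :- c :* (z :- x))
            refl x y z (f x) (f y) (f z) c))
          (≤-trans (∣x+y∣≤∣x∣+∣y∣ _ _)
            (≤-respʳ-≈ (solve 4 (λ x y z e → e :* (y :- x) :+ e :* (z :- y) := e :* (z :- x))
                  refl x y z η)
              (+-mono-≤ Pxy Pyz)))

      local : ∀ s → s ∈[ a , b ] → ∣ s - t ∣ < δ → ∃ λ δ′ → 0# < δ′ ×
        (∀ z → z ∈[ a , b ] → ∣ z - s ∣ < δ′ → ∣ (f z - f s) - c * (z - s) ∣ ≤ η * ∣ z - s ∣)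
      local s s∈ s-near with f-der s s∈ (½ * η) (0<½* 0<η)
      ... | δ′ , 0<δ′ , close = δ′ , 0<δ′ , λ z z∈ z-near →
        ≤-respˡ-≈ (∣∣-cong (solve 6 (λ z s Z S c d →
            (Z :- S) :- d :* (z :- s) :+ (d :- c) :* (z :- s) := (Z :- S) :- c :* (z :- s))
            refl z s (f z) (f s) c (f′ s)))
          (≤-trans (∣x+y∣≤∣x∣+∣y∣ _ _)
            (≤-respʳ-≈ (trans (sym (distribʳ _ _ _)) (*-congʳ (½x+½x≈x η)))
              (+-mono-≤ (close z z∈ z-near)
                (≤-trans (∣x*y∣≤∣x∣*∣y∣ _ _)
                  (*-monoʳ-≤ (0≤∣x∣ _) (proj₁ (f′-close s s∈ s-near)))))))

      main : ∀ i → Near δ i → ∣ slope f i - c ∣ ≤ η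
      main i (q-near , r-near) = ∣∣-cancelˡ-≤ (0<h i)
        (≤-respˡ-≈ (∣∣-cong (begin
            F - c * h i
              ≈⟨ +-congʳ (trans (*-congʳ (h*h⁻¹≈1 i)) (*-identityˡ F)) ⟨
            (h i * h i ⁻¹) * F - c * h i
              ≈⟨ solve 4 (λ h j F c → (h :* j) :* F :- c :* h := h :* (F :* j :- c))
                    refl (h i) (h i ⁻¹) F c ⟩
            h i * (slope f i - c) ∎))
          (≤-respʳ-≈ (*-comm η (h i)) (cousin P (proj₁ (q<r i)) additive near)))
        where
        F = f (r i) - f (q i)
        near : ∀ s → s ∈[ q i , r i ] → ∃ λ δ → 0# < δ ×
          (∀ x y → q i ≤ x → x ≤ s → s ≤ y → y ≤ r i → ∣ x - s ∣ < δ → ∣ y - s ∣ < δ → P x y)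
        near s (q≤s , s≤r) =
          let δ′ , 0<δ′ , close = local s (≤-trans (a≤q i) q≤s , ≤-trans s≤r (r≤b i)) (between q≤s s≤r q-near r-near)
          in δ′ , 0<δ′ , λ x y q≤x x≤s s≤y y≤r x-near y-near →
          additive x≤s s≤y
            (≤-respˡ-≈ (∣∣-cong (solve 5 (λ x s X S c → :- ((X :- S) :- c :* (x :- s)) := (S :- X) :- c :* (s :- x))
                  refl x s (f x) (f s) c))
              (≤-trans (∣-x∣≤∣x∣ _)
                (≤-trans (close x (≤-trans (a≤q i) q≤x , ≤-trans x≤s (≤-trans s≤r (r≤b i))) x-near)
                  (*-monoˡ-≤ (proj₁ 0<η) (≤-trans (∣x-y∣≤∣y-x∣ x s)
                    (≤-reflexive (0≤x⇒∣x∣≈x (x≤y⇒0≤y-x x≤s))))))))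
            (≤-trans (close y (≤-trans (a≤q i) (≤-trans q≤s s≤y) , ≤-trans y≤r (r≤b i)) y-near)
              (*-monoˡ-≤ (proj₁ 0<η) (≤-reflexive (0≤x⇒∣x∣≈x (x≤y⇒0≤y-x s≤y)))))

-- Riemann integrals of strict derivatives

module Integration (em : ExcludedMiddle 0ℓ) (ℝ : CompleteOrderedField) where
  open CompleteOrderedField ℝ hiding (zero)
  open Analysis ℝ
  open OrderedField em ℝ
  open Calculus em ℝ
  open SetoidReasoning setoid
  open TaggedSubinterval

  partition-≤ : ∀ {δ x y} → TaggedPartition δ x y → x ≤ y
  partition-≤ ε       = ≤-refl
  partition-≤ (I ◅ P) = ≤-trans (≤-trans a≤tag tag≤b) (partition-≤ P)
    where open TaggedInterval I

  module _ {a b : Carrier} {Φ f : Carrier → Carrier}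
    (a≤b    : a ≤ b)
    (Φ-cong : ∀ {x y} → x ∈[ a , b ] → y ∈[ a , b ] → x ≈ y → Φ x ≈ Φ y)
    (Φ-f    : ∀ t → t ∈[ a , b ] → At.Null a b t (λ i → At.slope a b t Φ i - f (p i)))
    where

    Deviation≤ : Carrier → TaggedSubinterval a b → Set
    Deviation≤ η i = ∣ f (p i) * h i - (Φ (r i) - Φ (q i)) ∣ ≤ η * h i

    private
      -- Only the tag is confined to `x` and `y`, while the interval may stick out. An interval
      -- straddling a point of division is therefore still covered by one of the two halves, which
      -- makes the property additive.
      Uniform : Carrier → Rel Carrier 0ℓ
      Uniform η x y = ∃ λ δ → 0# < δ × (∀ i → x ≤ p i → p i ≤ y → h i < δ → Deviation≤ η i)

    uniform : ∀ η → 0# < η → ∃ λ δ → 0# < δ × (∀ i → h i < δ → Deviation≤ η i)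
    uniform η 0<η =
      let δ , 0<δ , dev = cousin (Uniform η) a≤b additive local
      in δ , 0<δ , λ i → dev i (proj₁ (p∈ i)) (proj₂ (p∈ i))
      where
      additive : ∀ {x y z} → x ≤ y → y ≤ z → Uniform η x y → Uniform η y z → Uniform η x z
      additive {y = y} _ _ (δ₁ , 0<δ₁ , dev₁) (δ₂ , 0<δ₂ , dev₂) with commonLowerBound 0<δ₁ 0<δ₂
      ... | δ , 0<δ , δ≤δ₁ , δ≤δ₂ = δ , 0<δ , λ i x≤p p≤z h<δ →
        [ (λ p≤y → dev₁ i x≤p p≤y (<-≤-trans h<δ δ≤δ₁))
        , (λ y≤p → dev₂ i y≤p p≤z (<-≤-trans h<δ δ≤δ₂)) ]′ (total (p i) y)

      local : ∀ t → t ∈[ a , b ] → ∃ λ δ → 0# < δ ×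
        (∀ x y → a ≤ x → x ≤ t → t ≤ y → y ≤ b → ∣ x - t ∣ < δ → ∣ y - t ∣ < δ → Uniform η x y)
      local t t∈ with At.bound (Φ-f t t∈) η 0<η
      -- One half of δ bounds the distance from the tag to `t`, the other the length of the
      -- interval, so both endpoints stay within δ of `t`.
      ... | δ , 0<δ , close = ½ * δ , 0<½* 0<δ , λ x y _ _ _ _ x-near y-near →
        ½ * δ , 0<½* 0<δ , λ i x≤p p≤y h<δ/2 →
          let p-near : ∣ p i - t ∣ < ½ * δ
              p-near = between x≤p p≤y x-near y-near
              move : ∀ z → ∣ z - p i ∣ ≤ h i → ∣ z - t ∣ < δ
              move z z-p≤h = ≤-<-trans (≤-respˡ-≈ (∣∣-cong (solve 3 (λ z p t → (z :- p) :+ (p :- t) := z :- t)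
                    refl z (p i) t))
                  (≤-trans (∣x+y∣≤∣x∣+∣y∣ _ _) (+-mono-≤ z-p≤h (proj₁ p-near))))
                (<-by (x<y⇒0<y-x h<δ/2) (trans (solve 2 (λ h d → d :- h := (d :+ d) :- (h :+ d))
                      refl (h i) (½ * δ)) (+-congʳ (½x+½x≈x δ))))
              q-p≤h : ∣ q i - p i ∣ ≤ h i
              q-p≤h = ≤-trans (∣x-y∣≤∣y-x∣ _ _)
                (≤-respˡ-≈ (sym (0≤x⇒∣x∣≈x (x≤y⇒0≤y-x (q≤p i)))) (+-monoˡ-≤ (- q i) (p≤r i)))
              r-p≤h : ∣ r i - p i ∣ ≤ h i
              r-p≤h = ≤-respˡ-≈ (sym (0≤x⇒∣x∣≈x (x≤y⇒0≤y-x (p≤r i))))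
                (≤-by (x≤y⇒0≤y-x (q≤p i)) (solve 3 (λ q p r → p :- q := (r :- q) :- (r :- p))
                      refl (q i) (p i) (r i)))
          in deviation i (close i (move (q i) q-p≤h , move (r i) r-p≤h))
        where
        deviation : ∀ i → ∣ At.slope a b t Φ i - f (p i) ∣ ≤ η → Deviation≤ η i
        deviation i slope≤η = ≤-respˡ-≈ (∣∣-cong (begin
            (f (p i) - F * h i ⁻¹) * h i
              ≈⟨ solve 4 (λ v F h j → (v :- F :* j) :* h := v :* h :- F :* (h :* j))
                    refl (f (p i)) F (h i) (h i ⁻¹) ⟩
            f (p i) * h i - F * (h i * h i ⁻¹)
              ≈⟨ +-congˡ (-‿cong (trans (*-congˡ (h*h⁻¹≈1 i)) (*-identityʳ F))) ⟩
            f (p i) * h i - F ∎))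
          (≤-trans (∣x*y∣≤∣x∣*∣y∣ _ _)
            (≤-respˡ-≈ (*-congˡ (sym (0≤x⇒∣x∣≈x (proj₁ (0<h i)))))
              (*-monoʳ-≤ (proj₁ (0<h i)) (≤-trans (∣x-y∣≤∣y-x∣ _ _) slope≤η))))
          where F = Φ (r i) - Φ (q i)

    -- The increments of `Φ` telescope along the partition, and the errors, each at most η times a
    -- length, add up to η times the total length.
    riemannSum-deviation : ∀ {η δ} → 0# < η → (∀ i → h i < δ → Deviation≤ η i) →
      ∀ {x} → a ≤ x → (P : TaggedPartition δ x b) →
      ∣ riemannSum f P - (Φ b - Φ x) ∣ ≤ η * (b - x)
    riemannSum-deviation {η} 0<η dev a≤x ε = ≤-reflexive (trans
      (trans (∣∣-cong (solve 1 (λ x → :0 :- (x :- x) := :0) refl (Φ b))) (0≤x⇒∣x∣≈x ≤-refl))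
      (solve 2 (λ e x → :0 := e :* (x :- x)) refl η b))
    riemannSum-deviation {η} {δ} 0<η dev {x} a≤x (_◅_ {j = y} I P) =
      ≤-respˡ-≈ (∣∣-cong (solve 5 (λ T S X Y Z → T :- (Y :- X) :+ (S :- (Z :- Y)) := T :+ S :- (Z :- X))
          refl (f tag * (y - x)) (riemannSum f P) (Φ x) (Φ y) (Φ b)))
        (≤-trans (∣x+y∣≤∣x∣+∣y∣ _ _)
          (≤-respʳ-≈ (solve 4 (λ e x y z → e :* (y :- x) :+ e :* (z :- y) := e :* (z :- x)) refl η x y b)
            (+-mono-≤ first (riemannSum-deviation 0<η dev (≤-trans a≤x x≤y) P))))
      where
      open TaggedInterval I
      x≤y : x ≤ y
      x≤y = ≤-trans a≤tag tag≤b
      y≤b : y ≤ b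
      y≤b = partition-≤ P
      first : ∣ f tag * (y - x) - (Φ y - Φ x) ∣ ≤ η * (y - x)
      -- A partition may contain intervals of length zero, which have no slope. Both terms vanish
      -- there, the second because `Φ` respects `≈`.
      first with em {x ≈ y}
      ... | no x≉y = dev (record { q = x ; p = tag ; r = y ; a≤q = a≤x ; q≤p = a≤tag ; p≤r = tag≤b
                                 ; r≤b = y≤b ; q<r = x≤y , x≉y }) mesh
      ... | yes x≈y = ≤-reflexive (begin
          ∣ f tag * (y - x) - (Φ y - Φ x) ∣
            ≈⟨ ∣∣-cong (+-cong (*-congˡ y-x≈0) (-‿cong (+-congʳ
                 (Φ-cong (≤-trans a≤x x≤y , y≤b) (a≤x , ≤-trans x≤y y≤b) (sym x≈y))))) ⟩
          ∣ f tag * 0# - (Φ x - Φ x) ∣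
            ≈⟨ ∣∣-cong (solve 2 (λ v w → v :* :0 :- (w :- w) := :0) refl (f tag) (Φ x)) ⟩
          ∣ 0# ∣         ≈⟨ 0≤x⇒∣x∣≈x ≤-refl ⟩
          0#             ≈⟨ zeroʳ η ⟨
          η * 0#         ≈⟨ *-congˡ y-x≈0 ⟨
          η * (y - x)    ∎)
        where
        y-x≈0 : y - x ≈ 0#
        y-x≈0 = trans (+-congˡ (-‿cong x≈y)) (-‿inverseʳ y)

    -- An error rate of ½η/(1 + b - a) accumulates to at most ½η over the interval. The summand 1
    -- keeps the divisor positive when the interval is a point.
    fundamentalTheorem : HasIntegral a b f (Φ b - Φ a)
    fundamentalTheorem η 0<η =
      let δ , 0<δ , dev = uniform (½ * η * k ⁻¹) 0<η′
      in δ , 0<δ , λ P →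
      ≤-<-trans (≤-trans (riemannSum-deviation 0<η′ dev ≤-refl P)
          (≤-respʳ-≈ (trans (*-assoc _ _ _) (trans (*-congˡ (*-inverseˡ k (0<⇒≉0 0<k))) (*-identityʳ _)))
            (*-monoˡ-≤ (proj₁ 0<η′) (≤-by 0≤1 (solve 1 (λ c → :1 := :1 :+ c :- c) refl (b - a))))))
        (½x<x 0<η)
      where
      k = 1# + (b - a)
      0<k : 0# < k
      0<k = 0<+ 0<1 (x≤y⇒0≤y-x a≤b)
      0<η′ : 0# < ½ * η * k ⁻¹
      0<η′ = 0<* (0<½* 0<η) (0<⁻¹ 0<k)

-- The Heron form and the reverse Cauchy-Schwarz inequality

module Triangle (em : ExcludedMiddle 0ℓ) (ℝ : CompleteOrderedField) where
  open CompleteOrderedField ℝ hiding (zero)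
  open OrderedField em ℝ
  open SetoidReasoning setoid

  -- With a, b, c equal to half the squared side lengths, Heron's formula says
  -- that this is four times the squared area.
  heron : (a b c : Carrier) → Carrier
  heron a b c = (b + c) * (b + c) - (b - c) * (b - c) - (b + c - a) * (b + c - a)

  -- The polarisation of heron.
  pairing : (a b c a′ b′ c′ : Carrier) → Carrier
  pairing a b c a′ b′ c′ = (b + c - a) * a′ + ((c + a - b) * b′ + ((a + b - c) * c′ + 0#))

  abstract
    heron-cong : ∀ {a b c a′ b′ c′} → a ≈ a′ → b ≈ b′ → c ≈ c′ → heron a b c ≈ heron a′ b′ c′
    heron-cong a≈ b≈ c≈ = +-cong (+-cong (sq (+-cong b≈ c≈)) (-‿cong (sq (+-cong b≈ (-‿cong c≈)))))
                            (-‿cong (sq (+-cong (+-cong b≈ c≈) (-‿cong a≈))))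
      where
      sq : ∀ {x y} → x ≈ y → x * x ≈ y * y
      sq x≈y = *-cong x≈y x≈y

    heron-rotate : ∀ a b c → heron b c a ≈ heron a b c
    heron-rotate = solve 3 (λ a b c →
      (c :+ a) :* (c :+ a) :- (c :- a) :* (c :- a) :- (c :+ a :- b) :* (c :+ a :- b) :=
      (b :+ c) :* (b :+ c) :- (b :- c) :* (b :- c) :- (b :+ c :- a) :* (b :+ c :- a)) refl

    -- In terms of the roots `x`, `y`, `z` this is Heron's factorisation into x + y + z, y + z - x,
    -- z + x - y and x + y - z, all of them positive.
    heron-triangle : ∀ {a b c} → 0# < a → 0# < b → 0# < c →
      √ a < √ b + √ c → √ b < √ c + √ a → √ c < √ a + √ b → 0# < heron a b c
    heron-triangle {a} {b} {c} 0<a 0<b 0<c x<y+z y<z+x z<x+y = <-respʳ-≈ (begin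
        ((x + y + z) * (y + z - x)) * ((z + x - y) * (x + y - z))
          ≈⟨ solve 3 (λ x y z → ((x :+ y :+ z) :* (y :+ z :- x)) :* ((z :+ x :- y) :* (x :+ y :- z)) :=
               (y :* y :+ z :* z) :* (y :* y :+ z :* z) :- (y :* y :- z :* z) :* (y :* y :- z :* z)
               :- (y :* y :+ z :* z :- x :* x) :* (y :* y :+ z :* z :- x :* x)) refl x y z ⟩
        heron (x * x) (y * y) (z * z)
          ≈⟨ heron-cong (√*√≈ (proj₁ 0<a)) (√*√≈ (proj₁ 0<b)) (√*√≈ (proj₁ 0<c)) ⟩
        heron a b c ∎)
      (0<* (0<* (0<+ (0<+ (0<√ 0<a) (0≤√ b)) (0≤√ c)) (x<y⇒0<y-x x<y+z)) (0<* (x<y⇒0<y-x y<z+x) (x<y⇒0<y-x z<x+y)))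
      where
      x y z : Carrier
      x = √ a
      y = √ b
      z = √ c

    -- If x ≥ y + z, then the factor y + z - x is nonpositive while z + x - y and x + y - z are sums
    -- of nonnegative terms, so the product cannot be positive.
    triangle-heron : ∀ {a b c} → 0# < a → 0# < b → 0# < c → 0# < heron a b c → √ a < √ b + √ c
    triangle-heron {a} {b} {c} 0<a 0<b 0<c 0<Q = ≰⇒> λ y+z≤x → <⇒≱ 0<Q
      (let 0≤x-y-z = x≤y⇒0≤y-x y+z≤x
           0≤x = 0≤√ a
           0≤y = 0≤√ b
           0≤z = 0≤√ c
           x = √ a ; y = √ b ; z = √ c
       in ≤-by
       (*-nonneg (*-nonneg (0≤+ (0≤+ 0≤x 0≤y) 0≤z) 0≤x-y-z)
         (*-nonneg (0≤+ 0≤x-y-z (0≤+ 0≤z 0≤z)) (0≤+ 0≤x-y-z (0≤+ 0≤y 0≤y))))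
       (begin
        ((x + y + z) * (x - (y + z))) * ((x - (y + z) + (z + z)) * (x - (y + z) + (y + y)))
          ≈⟨ solve 3 (λ x y z →
               ((x :+ y :+ z) :* (x :- (y :+ z))) :* ((x :- (y :+ z) :+ (z :+ z)) :* (x :- (y :+ z) :+ (y :+ y))) :=
               :0 :- ((y :* y :+ z :* z) :* (y :* y :+ z :* z) :- (y :* y :- z :* z) :* (y :* y :- z :* z)
               :- (y :* y :+ z :* z :- x :* x) :* (y :* y :+ z :* z :- x :* x))) refl x y z ⟩
        0# - heron (x * x) (y * y) (z * z)
          ≈⟨ +-congˡ (-‿cong (heron-cong (√*√≈ (proj₁ 0<a)) (√*√≈ (proj₁ 0<b)) (√*√≈ (proj₁ 0<c)))) ⟩
        0# - heron a b c ∎))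

    pairing-self : ∀ a b c → pairing a b c a b c ≈ heron a b c
    pairing-self = solve 3 (λ a b c →
      (b :+ c :- a) :* a :+ ((c :+ a :- b) :* b :+ ((a :+ b :- c) :* c :+ :0)) :=
      (b :+ c) :* (b :+ c) :- (b :- c) :* (b :- c) :- (b :+ c :- a) :* (b :+ c :- a)) refl

    -- The coordinates b + c, b - c and b + c - a diagonalise the form and show its signature (1,
    -- 2).
    pairing-lorentz : ∀ a b c a′ b′ c′ → pairing a b c a′ b′ c′ ≈
      (b + c) * (b′ + c′) - (b - c) * (b′ - c′) - (b + c - a) * (b′ + c′ - a′)
    pairing-lorentz = solve 6 (λ a b c a′ b′ c′ →
      (b :+ c :- a) :* a′ :+ ((c :+ a :- b) :* b′ :+ ((a :+ b :- c) :* c′ :+ :0)) :=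
      (b :+ c) :* (b′ :+ c′) :- (b :- c) :* (b′ :- c′) :- (b :+ c :- a) :* (b′ :+ c′ :- a′)) refl

    -- The vector X (X′, Y′, Z′) - X′ (X, Y, Z) is spacelike since its first
    -- coordinate vanishes.
    lorentz-identity : ∀ X Y Z X′ Y′ Z′ α β →
      α * α ≈ X * X - Y * Y - Z * Z → β * β ≈ X′ * X′ - Y′ * Y′ - Z′ * Z′ →
      2# * (X * X′) * ((X * X′ - Y * Y′ - Z * Z′) - α * β) ≈
      (X * β - X′ * α) * (X * β - X′ * α) +
      ((X * Y′ - X′ * Y) * (X * Y′ - X′ * Y) + (X * Z′ - X′ * Z) * (X * Z′ - X′ * Z))
    lorentz-identity X Y Z X′ Y′ Z′ α β α²≈ β²≈ = begin
      2# * (X * X′) * ((X * X′ - Y * Y′ - Z * Z′) - α * β)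
        ≈⟨ solve 6 (λ X X′ YY ZZ α β →
             :2 :* (X :* X′) :* ((X :* X′ :- YY :- ZZ) :- α :* β) :=
             :2 :* (X :* X′ :* (X :* X′)) :- :2 :* (X :* X′) :* (YY :+ ZZ) :- :2 :* (X :* X′ :* (α :* β)))
                   refl X X′ (Y * Y′) (Z * Z′) α β ⟩
      2# * (X * X′ * (X * X′)) - 2# * (X * X′) * (Y * Y′ + Z * Z′) - 2# * (X * X′ * (α * β))
        ≈⟨ solve 6 (λ X X′ D D′ K L →
             :2 :* (X :* X′ :* (X :* X′)) :- K :- L :=
             X :* X :* (X′ :* X′ :- D′) :+ X′ :* X′ :* (X :* X :- D) :- L :+ (X :* X :* D′ :+ X′ :* X′ :* D :- K))
             refl X X′ (Y * Y + Z * Z) (Y′ * Y′ + Z′ * Z′) (2# * (X * X′) * (Y * Y′ + Z * Z′)) (2# * (X * X′ * (α * β))) ⟩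
      X * X * (X′ * X′ - (Y′ * Y′ + Z′ * Z′)) + X′ * X′ * (X * X - (Y * Y + Z * Z)) - 2# * (X * X′ * (α * β))
        + (X * X * (Y′ * Y′ + Z′ * Z′) + X′ * X′ * (Y * Y + Z * Z) - 2# * (X * X′) * (Y * Y′ + Z * Z′))
        ≈⟨ +-cong (+-congʳ (+-cong (*-congˡ (trans (assoc X′ Y′ Z′) (sym β²≈)))
                                      (*-congˡ (trans (assoc X Y Z) (sym α²≈)))))
             (solve 6 (λ X X′ Y Z Y′ Z′ →
               X :* X :* (Y′ :* Y′ :+ Z′ :* Z′) :+ X′ :* X′ :* (Y :* Y :+ Z :* Z)
                 :- :2 :* (X :* X′) :* (Y :* Y′ :+ Z :* Z′) :=
               (X :* Y′ :- X′ :* Y) :* (X :* Y′ :- X′ :* Y) :+ (X :* Z′ :- X′ :* Z) :* (X :* Z′ :- X′ :* Z))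
                     refl X X′ Y Z Y′ Z′) ⟩
      X * X * (β * β) + X′ * X′ * (α * α) - 2# * (X * X′ * (α * β)) + W
        ≈⟨ +-congʳ (solve 4 (λ X X′ α β → X :* X :* (β :* β) :+ X′ :* X′ :* (α :* α) :- :2 :* (X :* X′ :* (α :* β)) :=
             (X :* β :- X′ :* α) :* (X :* β :- X′ :* α)) refl X X′ α β) ⟩
      (X * β - X′ * α) * (X * β - X′ * α) + W ∎
      where
      W : Carrier
      W = (X * Y′ - X′ * Y) * (X * Y′ - X′ * Y) + (X * Z′ - X′ * Z) * (X * Z′ - X′ * Z)
      assoc : ∀ x y z → x * x - (y * y + z * z) ≈ x * x - y * y - z * z
      assoc = solve 3 (λ x y z → x :* x :- (y :* y :+ z :* z) := x :* x :- y :* y :- z :* z) refl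

  module ReverseCauchySchwarz {a b c a′ b′ c′ : Carrier}
    (0<b : 0# < b) (0<c : 0# < c) (0<b′ : 0# < b′) (0<c′ : 0# < c′)
    (0<Q : 0# < heron a b c) (0<Q′ : 0# < heron a′ b′ c′) where

    private
      X X′ U V W α β : Carrier
      X = b + c
      X′ = b′ + c′
      α = √ (heron a b c)
      β = √ (heron a′ b′ c′)
      U = X * β - X′ * α
      V = X * (b′ - c′) - X′ * (b - c)
      W = X * (b′ + c′ - a′) - X′ * (b + c - a)

    abstract
      0<X : 0# < b + c
      0<X = 0<+ 0<b (proj₁ 0<c)

      0<2XX′ : 0# < 2# * (X * X′)
      0<2XX′ = 0<* 0<2 (0<* 0<X (0<+ 0<b′ (proj₁ 0<c′)))

      -- An exact sum of squares instead of an estimate, so that the inequality and its equality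
      -- case come from the same formula.
      identity : 2# * (X * X′) * (pairing a b c a′ b′ c′ - α * β) ≈ U * U + (V * V + W * W)
      identity = trans (*-congˡ (+-congʳ (pairing-lorentz a b c a′ b′ c′)))
        (lorentz-identity X (b - c) (b + c - a) X′ (b′ - c′) (b′ + c′ - a′) α β
          (√*√≈ (proj₁ 0<Q)) (√*√≈ (proj₁ 0<Q′)))

      pairing-≥ : √ (heron a b c) * √ (heron a′ b′ c′) ≤ pairing a b c a′ b′ c′
      pairing-≥ = ≤-by (*-cancelˡ-≤ 0<2XX′ (≤-respˡ-≈ (sym (zeroʳ _)) (≤-respʳ-≈ (sym identity)
        (0≤+ (0≤x*x U) (0≤+ (0≤x*x V) (0≤x*x W)))))) refl

      module Equality (equal : pairing a b c a′ b′ c′ ≈ √ (heron a b c) * √ (heron a′ b′ c′)) where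
        squares≈0 : U * U + (V * V + W * W) ≈ 0#
        squares≈0 = trans (sym identity) (trans (*-congˡ (trans (+-congʳ equal) (-‿inverseʳ _))) (zeroʳ _))
        V²+W²≈0 : V * V + W * W ≈ 0#
        V²+W²≈0 = 0≤x∧y≈0⇒x≈0 (0≤+ (0≤x*x V) (0≤x*x W)) (0≤x*x U) (trans (+-comm _ _) squares≈0)
        V≈0 : V ≈ 0#
        V≈0 = x*x≈0⇒x≈0 (0≤x∧y≈0⇒x≈0 (0≤x*x V) (0≤x*x W) V²+W²≈0)
        W≈0 : W ≈ 0#
        W≈0 = x*x≈0⇒x≈0 (0≤x∧y≈0⇒x≈0 (0≤x*x W) (0≤x*x V) (trans (+-comm _ _) V²+W²≈0))

        x≈y+0 : ∀ {x y z} → x ≈ y + z → z ≈ 0# → x ≈ y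
        x≈y+0 x≈y+z z≈0 = trans x≈y+z (trans (+-congˡ z≈0) (+-identityʳ _))

        -- `V ≈ 0` and `W ≈ 0` say that the two triples of Lorentz coordinates are parallel, with
        -- ratio X′ : X. Going back to side coordinates, `W` gives this equation, and `V` gives the
        -- next two after doubling.
        proportional-a : (b + c) * a′ ≈ (b′ + c′) * a
        proportional-a = x≈y+0 (solve 6 (λ a b c a′ b′ c′ → (b :+ c) :* a′ := (b′ :+ c′) :* a :+
            (:- ((b :+ c) :* (b′ :+ c′ :- a′) :- (b′ :+ c′) :* (b :+ c :- a)))) refl a b c a′ b′ c′)
          (trans (-‿cong W≈0) (solve 0 (:- :0 := :0) refl))
        proportional-b : (b + c) * b′ ≈ (b′ + c′) * b
        proportional-b = *-cancelˡ-≈ (0<⇒≉0 0<2) (x≈y+0 (solve 4 (λ b c b′ c′ → :2 :* ((b :+ c) :* b′) :=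
            :2 :* ((b′ :+ c′) :* b) :+ ((b :+ c) :* (b′ :- c′) :- (b′ :+ c′) :* (b :- c)))
                  refl b c b′ c′) V≈0)
        proportional-c : (b + c) * c′ ≈ (b′ + c′) * c
        proportional-c = *-cancelˡ-≈ (0<⇒≉0 0<2) (x≈y+0 (solve 4 (λ b c b′ c′ → :2 :* ((b :+ c) :* c′) :=
            :2 :* ((b′ :+ c′) :* c) :+ (:- ((b :+ c) :* (b′ :- c′) :- (b′ :+ c′) :* (b :- c))))
                  refl b c b′ c′)
          (trans (-‿cong V≈0) (solve 0 (:- :0 := :0) refl)))

-- Finite sums and Kronecker deltas

module Sums (em : ExcludedMiddle 0ℓ) (ℝ : CompleteOrderedField) where
  open CompleteOrderedField ℝ hiding (zero)
  open OrderedField em ℝ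
  open SemiringSum semiring using (sum-cong-≋; *-distribˡ-sum; sum-replicate-zero)
  open SetoidReasoning setoid

  sum-mono : ∀ {n} {x y : Vector Carrier n} → (∀ i → x i ≤ y i) → sum x ≤ sum y
  sum-mono {ℕ.zero}  x≤y = ≤-refl
  sum-mono {ℕ.suc n} x≤y = +-mono-≤ (x≤y zero) (sum-mono (x≤y ∘ suc))

  sum-- : ∀ {n} (x y : Vector Carrier n) → sum x - sum y ≈ sum (λ i → x i - y i)
  sum-- {ℕ.zero}  x y = -‿inverseʳ 0#
  sum-- {ℕ.suc n} x y = trans
    (solve 4 (λ x y X Y → x :+ X :- (y :+ Y) := (x :- y) :+ (X :- Y))
          refl (x zero) (y zero) (sum (x ∘ suc)) (sum (y ∘ suc)))
    (+-congˡ (sum-- (x ∘ suc) (y ∘ suc)))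

  -- The gaps `y i - x i` are nonnegative and their total is at most zero.
  sum-equal : ∀ {n} {x y : Vector Carrier n} → (∀ i → x i ≤ y i) → sum y ≤ sum x → ∀ i → x i ≈ y i
  sum-equal {ℕ.suc n} {x} {y} x≤y Σy≤Σx zero = antisym (x≤y zero)
    (≤-by (0≤+ (x≤y⇒0≤y-x Σy≤Σx) (x≤y⇒0≤y-x (sum-mono (x≤y ∘ suc))))
      (solve 4 (λ x y X Y → x :+ X :- (y :+ Y) :+ (Y :- X) := x :- y)
            refl (x zero) (y zero) (sum (x ∘ suc)) (sum (y ∘ suc))))
  sum-equal {ℕ.suc n} {x} {y} x≤y Σy≤Σx (suc i) = sum-equal (x≤y ∘ suc)
    (≤-by (0≤+ (x≤y⇒0≤y-x Σy≤Σx) (x≤y⇒0≤y-x (x≤y zero)))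
      (solve 4 (λ x y X Y → x :+ X :- (y :+ Y) :+ (y :- x) := X :- Y)
            refl (x zero) (y zero) (sum (x ∘ suc)) (sum (y ∘ suc)))) i

  0≤sum : ∀ {n} {x : Vector Carrier n} → (∀ i → 0# ≤ x i) → 0# ≤ sum x
  0≤sum {ℕ.zero}  0≤x = ≤-refl
  0≤sum {ℕ.suc n} 0≤x = 0≤+ (0≤x zero) (0≤sum (0≤x ∘ suc))

  0<sum : ∀ {n} {x : Vector Carrier n} → Fin n → (∀ i → 0# < x i) → 0# < sum x
  0<sum {ℕ.suc n} _ 0<x = 0<+ (0<x zero) (0≤sum (λ i → proj₁ (0<x (suc i))))

  -- Recursion on both indices, instead of a test for equality, makes `sum-δ` a plain structural
  -- induction.
  δ : ∀ {n} → Fin n → Fin n → Carrier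
  δ zero    zero    = 1#
  δ zero    (suc j) = 0#
  δ (suc i) zero    = 0#
  δ (suc i) (suc j) = δ i j

  δ-refl : ∀ {n} (i : Fin n) → δ i i ≈ 1#
  δ-refl zero    = refl
  δ-refl (suc i) = δ-refl i

  δ-≢ : ∀ {n} {i j : Fin n} → i ≢ j → δ i j ≈ 0#
  δ-≢ {i = zero}  {zero}  i≢j = contradiction ≡.refl i≢j
  δ-≢ {i = zero}  {suc j} i≢j = refl
  δ-≢ {i = suc i} {zero}  i≢j = refl
  δ-≢ {i = suc i} {suc j} i≢j = δ-≢ (i≢j ∘ ≡.cong suc)

  sum-δ : ∀ {n} (x : Vector Carrier n) i → sum (λ j → x j * δ j i) ≈ x i
  sum-δ {ℕ.suc n} x zero = begin
    x zero * 1# + sum (λ j → x (suc j) * 0#) ≈⟨ +-cong (*-identityʳ _) (sum-cong-≋ (λ j → zeroʳ (x (suc j)))) ⟩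
    x zero + sum {n} (λ j → 0#)              ≈⟨ +-congˡ (sum-replicate-zero n) ⟩
    x zero + 0#                              ≈⟨ +-identityʳ _ ⟩
    x zero                                   ∎
  sum-δ {ℕ.suc n} x (suc i) = trans (+-cong (zeroʳ _) (sum-δ (x ∘ suc) i)) (+-identityˡ _)

  δ² : ∀ {m n} → Fin m × Fin n → Fin m × Fin n → Carrier
  δ² (i , k) (j , l) = δ i j * δ k l

  δ²-refl : ∀ {m n} (s : Fin m × Fin n) → δ² s s ≈ 1#
  δ²-refl (i , k) = trans (*-cong (δ-refl i) (δ-refl k)) (*-identityˡ 1#)

  δ²-≢ : ∀ {m n} {s t : Fin m × Fin n} → s ≢ t → δ² s t ≈ 0#
  δ²-≢ {s = i , k} {j , l} s≢t with i Fin.≟ j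
  ... | no i≢j = trans (*-congʳ (δ-≢ i≢j)) (zeroˡ _)
  ... | yes ≡.refl = trans (*-congˡ (δ-≢ (s≢t ∘ ≡.cong (i ,_)))) (zeroʳ _)

  sum-δ² : ∀ {m n} (x : Fin m × Fin n → Carrier) s →
    sum (λ i → sum λ k → x (i , k) * δ² (i , k) s) ≈ x s
  sum-δ² x (j , l) = begin
    sum (λ i → sum λ k → x (i , k) * (δ i j * δ k l))
      ≈⟨ sum-cong-≋ (λ i → sum-cong-≋ (λ k → solve 3 (λ x d e → x :* (d :* e) := d :* (x :* e))
            refl (x (i , k)) (δ i j) (δ k l))) ⟩
    sum (λ i → sum λ k → δ i j * (x (i , k) * δ k l))
      ≈⟨ sum-cong-≋ (λ i → *-distribˡ-sum (δ i j) (λ k → x (i , k) * δ k l)) ⟨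
    sum (λ i → δ i j * sum λ k → x (i , k) * δ k l)
      ≈⟨ sum-cong-≋ (λ i → trans (*-congˡ (sum-δ (λ k → x (i , k)) l)) (*-comm _ _)) ⟩
    sum (λ i → x (i , l) * δ i j)
      ≈⟨ sum-δ (λ i → x (i , l)) j ⟩
    x (j , l) ∎

-- Cotangent weights as the gradient of a concave area

module Surface (em : ExcludedMiddle 0ℓ) (ℝ : CompleteOrderedField) (T : TriangulatedSurface) where
  open CompleteOrderedField ℝ hiding (zero)
  open OrderedField em ℝ
  open Triangle em ℝ
  open Sums em ℝ
  open SemiringSum semiring using (sum-cong-≋; ∑-distrib-+; ∑-comm; *-distribˡ-sum; *-distribʳ-sum)
  open TriangulatedSurface T
  open PolyhedralMetric ℝ T
  open SetoidReasoning setoid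

  abstract
    -- The side lengths satisfy y² = 2b and z² = 2c, so yz times the cosine is b + c - a by the law
    -- of cosines. Hence (yz)² times the squared sine is 4bc - (b + c - a)², and yz times the sine
    -- is `√ Q`. The factor yz cancels in the quotient.
    cotAngle-heron : ∀ {a b c} → 0# < a → 0# < b → 0# < c → 0# < heron a b c →
      cotAngle (√ (2# * a)) (√ (2# * b)) (√ (2# * c)) * √ (heron a b c) ≈ b + c - a
    cotAngle-heron {a} {b} {c} 0<a 0<b 0<c 0<Q = begin
        (cs * s ⁻¹) * √ Q        ≈⟨ *-congˡ √Q≈ ⟩
        (cs * s ⁻¹) * (yz * s)
          ≈⟨ solve 4 (λ c j y s → (c :* j) :* (y :* s) := (y :* c) :* (s :* j)) refl cs (s ⁻¹) yz s ⟩
        (yz * cs) * (s * s ⁻¹)   ≈⟨ *-cong yz*cs≈n (*-inverseʳ s s≉0) ⟩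
        n * 1#                   ≈⟨ *-identityʳ n ⟩
        n                        ∎
      where
      x y z yz n cs s Q : Carrier
      x = √ (2# * a)
      y = √ (2# * b)
      z = √ (2# * c)
      yz = y * z
      n = b + c - a
      cs = cosAngle x y z
      s = sinAngle x y z
      Q = heron a b c

      sq : ∀ {a} → 0# < a → √ (2# * a) * √ (2# * a) ≈ 2# * a
      sq 0<a = √*√≈ (proj₁ (0<* 0<2 0<a))
      0<yz : 0# < yz
      0<yz = 0<* (0<√ (0<* 0<2 0<b)) (0<√ (0<* 0<2 0<c))
      0<2yz : 0# < 2# * y * z
      0<2yz = <-respʳ-≈ (sym (*-assoc 2# y z)) (0<* 0<2 0<yz)

      yz*cs≈n : yz * cs ≈ n
      yz*cs≈n = *-cancelˡ-≈ (0<⇒≉0 0<2) (begin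
        2# * (yz * cs)
          ≈⟨ solve 5 (λ t y z N j → t :* ((y :* z) :* (N :* j)) := N :* ((t :* y :* z) :* j))
                refl 2# y z N ((2# * y * z) ⁻¹) ⟩
        N * ((2# * y * z) * (2# * y * z) ⁻¹)
          ≈⟨ trans (*-congˡ (*-inverseʳ _ (0<⇒≉0 0<2yz))) (*-identityʳ N) ⟩
        y * y + z * z - x * x
          ≈⟨ +-cong (+-cong (sq 0<b) (sq 0<c)) (-‿cong (sq 0<a)) ⟩
        2# * b + 2# * c - 2# * a
          ≈⟨ solve 4 (λ t a b c → t :* b :+ t :* c :- t :* a := t :* (b :+ c :- a)) refl 2# a b c ⟩
        2# * n ∎)
        where
        N : Carrier
        N = y * y + z * z - x * x

      yz²[1-cs²]≈Q : yz * yz * (1# - cs * cs) ≈ Q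
      yz²[1-cs²]≈Q = begin
        yz * yz * (1# - cs * cs)
          ≈⟨ solve 3 (λ y z c → (y :* z) :* (y :* z) :* (:1 :- c :* c) :=
                (y :* y) :* (z :* z) :- ((y :* z) :* c) :* ((y :* z) :* c)) refl y z cs ⟩
        (y * y) * (z * z) - (yz * cs) * (yz * cs)
          ≈⟨ +-cong (*-cong (sq 0<b) (sq 0<c)) (-‿cong (*-cong yz*cs≈n yz*cs≈n)) ⟩
        (2# * b) * (2# * c) - n * n
          ≈⟨ +-congʳ (solve 2 (λ b c → (:2 :* b) :* (:2 :* c) :=
                (b :+ c) :* (b :+ c) :- (b :- c) :* (b :- c)) refl b c) ⟩
        Q ∎

      0≤1-cs² : 0# ≤ 1# - cs * cs
      0≤1-cs² = *-cancelˡ-≤ (0<* 0<yz 0<yz)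
        (≤-respˡ-≈ (sym (zeroʳ _)) (≤-respʳ-≈ (sym yz²[1-cs²]≈Q) (proj₁ 0<Q)))

      √Q≈ : √ Q ≈ yz * s
      √Q≈ = √-unique (*-nonneg (proj₁ 0<yz) (0≤√ _)) (begin
        (yz * s) * (yz * s)
          ≈⟨ solve 2 (λ y s → (y :* s) :* (y :* s) := (y :* y) :* (s :* s)) refl yz s ⟩
        (yz * yz) * (s * s)        ≈⟨ *-congˡ (√*√≈ 0≤1-cs²) ⟩
        yz * yz * (1# - cs * cs)   ≈⟨ yz²[1-cs²]≈Q ⟩
        Q                          ∎)

      s≉0 : s ≉0
      s≉0 s≈0 = 0<⇒≉0 (0<√ 0<Q) (trans √Q≈ (trans (*-congˡ s≈0) (zeroʳ yz)))

  sideValue : Vector Carrier #edges → Fin #faces → Fin 3 → Carrier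
  sideValue u f k = u (edge (f , k))

  -- As `u` is half the squared length, this is four times the squared area of the face; hence the
  -- factor `½` in `area`.
  area² : Vector Carrier #edges → Fin #faces → Carrier
  area² u f = heron (sideValue u f zero) (sideValue u f (suc zero)) (sideValue u f (suc (suc zero)))

  -- What the estimates on faces use of `Admissible`: the triangle inequalities in polynomial form,
  -- without the normalisation.
  record Nondegenerate (u : Vector Carrier #edges) : Set where
    field
      positive : ∀ i → 0# < u i
      0<area²  : ∀ f → 0# < area² u f
  open Nondegenerate public

  admissible⇒nondegenerate : ∀ {u} → Admissible u → Nondegenerate u
  admissible⇒nondegenerate adm = record
    { positive = Admissible.positive adm
    ; 0<area²  = λ f → heron-triangle (pos (edge (f , zero)))
        (pos (edge (f , suc zero))) (pos (edge (f , suc (suc zero))))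
        (Admissible.triangle adm f zero) (Admissible.triangle adm f (suc zero))
        (Admissible.triangle adm f (suc (suc zero)))
    }
    where pos = Admissible.positive adm

  rotated : Vector Carrier #edges → Fin #faces → Fin 3 → Carrier
  rotated u f k = heron (sideValue u f k) (sideValue u f (next k)) (sideValue u f (next (next k)))

  numerator : Vector Carrier #edges → Side #faces → Carrier
  numerator u (f , k) = sideValue u f (next k) + sideValue u f (next (next k)) - sideValue u f k

  abstract
    rotated≈ : ∀ u f k → rotated u f k ≈ area² u f
    rotated≈ u f zero             = refl
    rotated≈ u f (suc zero)       = heron-rotate _ _ _
    rotated≈ u f (suc (suc zero)) = trans (heron-rotate _ _ _) (heron-rotate _ _ _)

    cotOpposite-* : ∀ {u} → Nondegenerate u → ∀ f k → cotOpposite u (f , k) * √ (area² u f) ≈ numerator u (f , k)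
    cotOpposite-* {u} nd f k = trans (*-congˡ (sym (√-cong (rotated≈ u f k))))
      (cotAngle-heron (positive nd _) (positive nd _) (positive nd _)
        (<-respʳ-≈ (sym (rotated≈ u f k)) (0<area² nd f)))

    cotOpposite≈ : ∀ {u} → Nondegenerate u → ∀ f k → cotOpposite u (f , k) ≈ numerator u (f , k) * √ (area² u f) ⁻¹
    cotOpposite≈ {u} nd f k = begin
      C                   ≈⟨ *-identityʳ C ⟨
      C * 1#              ≈⟨ *-congˡ (*-inverseʳ A (0<⇒≉0 (0<√ (0<area² nd f)))) ⟨
      C * (A * A ⁻¹)      ≈⟨ *-assoc C A (A ⁻¹) ⟨
      (C * A) * A ⁻¹      ≈⟨ *-congʳ (cotOpposite-* nd f k) ⟩
      numerator u (f , k) * A ⁻¹ ∎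
      where
      C A : Carrier
      C = cotOpposite u (f , k)
      A = √ (area² u f)

  faceSum : (u v : Vector Carrier #edges) → Fin #faces → Carrier
  faceSum u v f = sum λ k → cotOpposite u (f , k) * v (edge (f , k))

  facePairing : (u v : Vector Carrier #edges) → Fin #faces → Carrier
  facePairing u v f = pairing (sideValue u f zero) (sideValue u f (suc zero)) (sideValue u f (suc (suc zero)))
                              (sideValue v f zero) (sideValue v f (suc zero)) (sideValue v f (suc (suc zero)))

  module _ {u v : Vector Carrier #edges} (ndu : Nondegenerate u) (ndv : Nondegenerate v) (f : Fin #faces) where
    private
      module RCS = ReverseCauchySchwarz (positive ndu (edge (f , suc zero))) (positive ndu (edge (f , suc (suc zero))))
                     (positive ndv (edge (f , suc zero))) (positive ndv (edge (f , suc (suc zero))))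
                     (0<area² ndu f) (0<area² ndv f)
    abstract
      -- A cotangent multiplied by `√ Q` is linear in the coordinates of `u`, and these linear forms
      -- are the coefficients of the polarised Heron form.
      faceSum-* : √ (area² u f) * faceSum u v f ≈ facePairing u v f
      faceSum-* = trans (*-distribˡ-sum A (λ k → cotOpposite u (f , k) * v (edge (f , k))))
          (+-cong (term zero) (+-cong (term (suc zero)) (+-cong (term (suc (suc zero))) refl)))
        where
        A : Carrier
        A = √ (area² u f)
        term : ∀ k → A * (cotOpposite u (f , k) * v (edge (f , k))) ≈ numerator u (f , k) * v (edge (f , k))
        term k = trans (trans (sym (*-assoc _ _ _)) (*-congʳ (*-comm A _))) (*-congʳ (cotOpposite-* ndu f k))

      -- The right side is the value at `v` of the tangent plane of `√ Q` at `u`, which passes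
      -- through the origin by homogeneity. The bound is the reverse Cauchy-Schwarz inequality
      -- divided by the root at `u`.
      area≤faceSum : √ (area² v f) ≤ faceSum u v f
      area≤faceSum = *-cancelˡ-≤ (0<√ (0<area² ndu f)) (≤-respʳ-≈ (sym faceSum-*) RCS.pairing-≥)

      proportional : √ (area² v f) ≈ faceSum u v f → ∃ λ c → ∀ k → sideValue v f k ≈ c * sideValue u f k
      proportional equal = X′ * X ⁻¹ , scaled
        where
        X X′ : Carrier
        X = sideValue u f (suc zero) + sideValue u f (suc (suc zero))
        X′ = sideValue v f (suc zero) + sideValue v f (suc (suc zero))
        X≉0 : X ≉0
        X≉0 = 0<⇒≉0 RCS.0<X
        module Eq = RCS.Equality (sym (trans (*-congˡ equal) faceSum-*))
        solved : ∀ {x y} → X * y ≈ X′ * x → y ≈ (X′ * X ⁻¹) * x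
        solved {x} {y} Xy≈X′x = *-cancelˡ-≈ X≉0 (begin
          X * y                     ≈⟨ Xy≈X′x ⟩
          X′ * x                    ≈⟨ *-identityˡ _ ⟨
          1# * (X′ * x)             ≈⟨ *-congʳ (*-inverseʳ X X≉0) ⟨
          (X * X ⁻¹) * (X′ * x)
            ≈⟨ solve 4 (λ X j X′ x → (X :* j) :* (X′ :* x) := X :* ((X′ :* j) :* x)) refl X (X ⁻¹) X′ x ⟩
          X * ((X′ * X ⁻¹) * x)     ∎)
        scaled : ∀ k → sideValue v f k ≈ (X′ * X ⁻¹) * sideValue u f k
        scaled zero             = solved Eq.proportional-a
        scaled (suc zero)       = solved Eq.proportional-b
        scaled (suc (suc zero)) = solved Eq.proportional-c

  abstract
    -- Euler's identity for a function that is homogeneous of degree one.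
    area≈faceSum : ∀ {u} → Nondegenerate u → ∀ f → √ (area² u f) ≈ faceSum u u f
    area≈faceSum {u} nd f = *-cancelˡ-≈ (0<⇒≉0 (0<√ (0<area² nd f)))
      (trans (√*√≈ (proj₁ (0<area² nd f))) (trans (sym (pairing-self _ _ _)) (sym (faceSum-* nd nd f))))

  area : Vector Carrier #edges → Carrier
  area u = ½ * sum λ f → √ (area² u f)

  sumOverEdge : (C : Side #faces → Carrier) → ∀ {i} → EdgeType edge i → Carrier
  sumOverEdge C (boundary s _ _)         = C s
  sumOverEdge C (interior s t _ _ _ _ _) = C s + C t

  abstract
    -- The indicator of the sides lying on an edge is one delta for a boundary edge and a sum of two
    -- for an interior edge. The two sides may belong to the same face, but they are distinct, so
    -- neither is counted twice.
    sum-sides : ∀ (C : Side #faces → Carrier) {i} (e : EdgeType edge i) →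
      sum (λ f → sum λ k → C (f , k) * δ (edge (f , k)) i) ≈ sumOverEdge C e
    sum-sides C {i} (boundary s es≡i unique) = begin
        sum (λ f → sum λ k → C (f , k) * δ (edge (f , k)) i)
          ≈⟨ sum-cong-≋ (λ f → sum-cong-≋ (λ k → *-congˡ {C (f , k)} (indicator (f , k)))) ⟩
        sum (λ f → sum λ k → C (f , k) * δ² (f , k) s)
          ≈⟨ sum-δ² C s ⟩
        C s ∎
      where
      indicator : ∀ r → δ (edge r) i ≈ δ² r s
      indicator r with edge r Fin.≟ i
      ... | yes er≡i rewrite unique r er≡i | es≡i = trans (δ-refl i) (sym (δ²-refl s))
      ... | no er≢i = trans (δ-≢ er≢i) (sym (δ²-≢ λ r≡s → er≢i (≡.trans (≡.cong edge r≡s) es≡i)))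
    sum-sides C {i} (interior s t s≢t es≡i et≡i only _) = begin
        sum (λ f → sum λ k → C (f , k) * δ (edge (f , k)) i)
          ≈⟨ sum-cong-≋ (λ f → sum-cong-≋ (λ k → trans (*-congˡ {C (f , k)} (indicator (f , k))) (distribˡ _ _ _))) ⟩
        sum (λ f → sum λ k → C (f , k) * δ² (f , k) s + C (f , k) * δ² (f , k) t)
          ≈⟨ sum-cong-≋ (λ f → ∑-distrib-+ (λ k → C (f , k) * δ² (f , k) s) (λ k → C (f , k) * δ² (f , k) t)) ⟩
        sum (λ f → sum (λ k → C (f , k) * δ² (f , k) s) + sum (λ k → C (f , k) * δ² (f , k) t))
          ≈⟨ ∑-distrib-+ (λ f → sum (λ k → C (f , k) * δ² (f , k) s)) (λ f → sum (λ k → C (f , k) * δ² (f , k) t)) ⟩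
        sum (λ f → sum (λ k → C (f , k) * δ² (f , k) s)) + sum (λ f → sum (λ k → C (f , k) * δ² (f , k) t))
          ≈⟨ +-cong (sum-δ² C s) (sum-δ² C t) ⟩
        C s + C t ∎
      where
      indicator : ∀ r → δ (edge r) i ≈ δ² r s + δ² r t
      indicator r with edge r Fin.≟ i
      ... | no er≢i = trans (δ-≢ er≢i) (sym (trans (+-cong
              (δ²-≢ λ r≡s → er≢i (≡.trans (≡.cong edge r≡s) es≡i))
              (δ²-≢ λ r≡t → er≢i (≡.trans (≡.cong edge r≡t) et≡i))) (+-identityˡ 0#)))
      ... | yes er≡i with only r er≡i
      ... | inj₁ ≡.refl rewrite es≡i = trans (δ-refl i) (sym (trans (+-cong (δ²-refl s) (δ²-≢ s≢t)) (+-identityʳ 1#)))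
      ... | inj₂ ≡.refl rewrite et≡i = trans (δ-refl i) (sym (trans (+-cong (δ²-≢ (s≢t ∘ ≡.sym)) (δ²-refl t)) (+-identityˡ 1#)))

    weight≈ : ∀ u i → weight u i ≈ ½ * sumOverEdge (cotOpposite u) (edgeType i)
    weight≈ u i with edgeType i
    ... | boundary _ _ _           = refl
    ... | interior _ _ _ _ _ _ _   = refl

    -- Double counting: `sum-sides` spreads each weight over all sides, the sums are exchanged, and
    -- the sum over edges collapses because each side lies on a single edge.
    sum-weight : ∀ (u v : Vector Carrier #edges) →
      sum (λ i → weight u i * v i) ≈ ½ * sum (faceSum u v)
    sum-weight u v = begin
      sum (λ i → weight u i * v i)
        ≈⟨ sum-cong-≋ (λ i → trans (*-congʳ (trans (weight≈ u i)
             (*-congˡ (sym (sum-sides (cotOpposite u) (edgeType i)))))) (*-assoc _ _ _)) ⟩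
      sum (λ i → ½ * (sum (λ f → sum λ k → C f k * D f k i) * v i))
        ≈⟨ *-distribˡ-sum ½ (λ i → sum (λ f → sum λ k → C f k * D f k i) * v i) ⟨
      ½ * sum (λ i → sum (λ f → sum λ k → C f k * D f k i) * v i)
        ≈⟨ *-congˡ (sum-cong-≋ (λ i → trans (*-distribʳ-sum (v i) (λ f → sum λ k → C f k * D f k i))
             (sum-cong-≋ (λ f → *-distribʳ-sum (v i) (λ k → C f k * D f k i))))) ⟩
      ½ * sum (λ i → sum (λ f → sum λ k → C f k * D f k i * v i))
        ≈⟨ *-congˡ (∑-comm (λ i f → sum λ k → C f k * D f k i * v i)) ⟩
      ½ * sum (λ f → sum (λ i → sum λ k → C f k * D f k i * v i))
        ≈⟨ *-congˡ (sum-cong-≋ (λ f → ∑-comm (λ i k → C f k * D f k i * v i))) ⟩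
      ½ * sum (λ f → sum (λ k → sum λ i → C f k * D f k i * v i))
        ≈⟨ *-congˡ (sum-cong-≋ (λ f → sum-cong-≋ (λ k → evaluate f k))) ⟩
      ½ * sum (faceSum u v) ∎
      where
      C : Fin #faces → Fin 3 → Carrier
      C f k = cotOpposite u (f , k)
      D : Fin #faces → Fin 3 → Fin #edges → Carrier
      D f k i = δ (edge (f , k)) i
      evaluate : ∀ f k → sum (λ i → C f k * D f k i * v i) ≈ C f k * v (edge (f , k))
      evaluate f k = begin
        sum (λ i → C f k * D f k i * v i)
          ≈⟨ sum-cong-≋ (λ i → trans (*-congʳ (*-congˡ (δ-sym (edge (f , k)) i)))
               (solve 3 (λ c d v → c :* d :* v := c :* (v :* d))
                     refl (C f k) (δ i (edge (f , k))) (v i))) ⟩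
        sum (λ i → C f k * (v i * δ i (edge (f , k))))
          ≈⟨ *-distribˡ-sum (C f k) (λ i → v i * δ i (edge (f , k))) ⟨
        C f k * sum (λ i → v i * δ i (edge (f , k)))
          ≈⟨ *-congˡ (sum-δ v (edge (f , k))) ⟩
        C f k * v (edge (f , k)) ∎
        where
        δ-sym : ∀ {n} (i j : Fin n) → δ i j ≈ δ j i
        δ-sym zero    zero    = refl
        δ-sym zero    (suc j) = refl
        δ-sym (suc i) zero    = refl
        δ-sym (suc i) (suc j) = δ-sym i j

    area-≤ : ∀ {u v} → Nondegenerate u → Nondegenerate v → area v ≤ sum λ i → weight u i * v i
    area-≤ {u} {v} ndu ndv = ≤-respʳ-≈ (sym (sum-weight u v))
      (*-monoˡ-≤ (proj₁ 0<½) (sum-mono (area≤faceSum ndu ndv)))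

    area-≈ : ∀ {u} → Nondegenerate u → area u ≈ sum λ i → weight u i * u i
    area-≈ {u} nd = trans (*-congˡ (sum-cong-≋ (area≈faceSum nd))) (sym (sum-weight u u))

    area-concave : ∀ {u v} → Nondegenerate u → Nondegenerate v →
      area v - area u ≤ sum λ i → weight u i * (v i - u i)
    area-concave {u} {v} ndu ndv = ≤-respʳ-≈ (begin
        sum (λ i → weight u i * v i) - sum (λ i → weight u i * u i)
          ≈⟨ sum-- (λ i → weight u i * v i) (λ i → weight u i * u i) ⟩
        sum (λ i → weight u i * v i - weight u i * u i)
          ≈⟨ sum-cong-≋ (λ i → solve 3 (λ w x y → w :* x :- w :* y := w :* (x :- y))
                refl (weight u i) (v i) (u i)) ⟩
        sum (λ i → weight u i * (v i - u i)) ∎)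
      (≤-respˡ-≈ (+-congˡ (-‿cong (sym (area-≈ ndu)))) (+-monoˡ-≤ _ (area-≤ ndu ndv)))

    area-cong : ∀ {u v} → (∀ i → u i ≈ v i) → area u ≈ area v
    area-cong u≈v = *-congˡ (sum-cong-≋ {#faces} (λ f → √-cong
      (heron-cong (u≈v (edge (f , zero))) (u≈v (edge (f , suc zero))) (u≈v (edge (f , suc (suc zero)))))))

-- Continuity of differentiable functions and basic derivatives

module DerivativeRules (em : ExcludedMiddle 0ℓ) (ℝ : CompleteOrderedField) where
  open CompleteOrderedField ℝ hiding (zero)
  open Analysis ℝ
  open OrderedField em ℝ
  open SetoidReasoning setoid

  abstract
    differentiable⇒continuous : ∀ {a b f f′} → HasDerivativeOn a b f f′ → ContinuousOn a b f
    differentiable⇒continuous {a} {b} {f} {f′} der t t∈ η 0<η =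
      let k = 1# + ∣ f′ t ∣
          0<k : 0# < k
          0<k = 0<+ 0<1 (0≤∣x∣ _)
          δ₁ , 0<δ₁ , close = der t t∈ 1# 0<1
          δ , 0<δ , δ≤δ₁ , δ≤ = commonLowerBound 0<δ₁ (0<* (0<½* 0<η) (0<⁻¹ 0<k))
      in δ , 0<δ , λ s s∈ s-near → ≤-<-trans
        (≤-trans
          (≤-respˡ-≈ (∣∣-cong (solve 3 (λ F d x → F :- d :* x :+ d :* x := F)
                refl (f s - f t) (f′ t) (s - t)))
            (≤-trans (∣x+y∣≤∣x∣+∣y∣ _ _)
              (≤-respʳ-≈ (sym (distribʳ _ _ _))
                (+-mono-≤ (close s s∈ (<-≤-trans s-near δ≤δ₁)) (∣x*y∣≤∣x∣*∣y∣ (f′ t) (s - t))))))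
          (≤-respʳ-≈ (begin
              k * (½ * η * k ⁻¹)
                ≈⟨ solve 3 (λ k e j → k :* (e :* j) := e :* (k :* j)) refl k (½ * η) (k ⁻¹) ⟩
              ½ * η * (k * k ⁻¹)   ≈⟨ *-congˡ (*-inverseʳ k (0<⇒≉0 0<k)) ⟩
              ½ * η * 1#           ≈⟨ *-identityʳ _ ⟩
              ½ * η                ∎)
            (*-monoˡ-≤ (proj₁ 0<k) (≤-trans (proj₁ s-near) δ≤))))
        (½x<x 0<η)

    -- A function on `Carrier` need not respect `≈`, but continuity forces it on the interval: a
    -- positive distance between the values could be taken as the tolerance and would have to be
    -- smaller than itself.
    continuous⇒cong : ∀ {a b f} → ContinuousOn a b f →
      ∀ {x y} → x ∈[ a , b ] → y ∈[ a , b ] → x ≈ y → f x ≈ f y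
    continuous⇒cong {f = f} cont {x} {y} x∈ y∈ x≈y = antisym
        (≤-by (x≤y⇒0≤y-x (≤-trans (-x≤∣x∣ _) ∣d∣≤0)) (solve 2 (λ u v → :0 :- :- (v :- u) := v :- u)
              refl (f x) (f y)))
        (≤-by (x≤y⇒0≤y-x (≤-trans (x≤∣x∣ _) ∣d∣≤0)) (solve 2 (λ u v → :0 :- (v :- u) := u :- v)
              refl (f x) (f y)))
      where
      ∣d∣≤0 : ∣ f y - f x ∣ ≤ 0#
      ∣d∣≤0 = ≮⇒≥ λ 0<∣d∣ → let δ , 0<δ , close = cont x x∈ _ 0<∣d∣ in
        proj₂ (close y y∈ (<-respˡ-≈ (sym (trans (∣∣-cong (trans (+-congˡ (-‿cong x≈y)) (-‿inverseʳ y)))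
          (0≤x⇒∣x∣≈x ≤-refl))) 0<δ)) refl

    affine-derivative : ∀ {a b} k c → HasDerivativeOn a b (λ t → k + t * c) (λ _ → c)
    affine-derivative k c t t∈ η 0<η = 1# , 0<1 , λ s s∈ _ → ≤-respˡ-≈
      (sym (trans (∣∣-cong (solve 4 (λ k c s t → (k :+ s :* c :- (k :+ t :* c)) :- c :* (s :- t) := :0)
            refl k c s t)) (0≤x⇒∣x∣≈x ≤-refl)))
      (*-nonneg (proj₁ 0<η) (0≤∣x∣ _))

    const-continuous : ∀ {a b} c → ContinuousOn a b (λ _ → c)
    const-continuous c t t∈ η 0<η = 1# , 0<1 , λ s s∈ _ →
      <-respˡ-≈ (sym (trans (∣∣-cong (-‿inverseʳ c)) (0≤x⇒∣x∣≈x ≤-refl))) 0<η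

-- The potential along paths and its minimisers

module Energy (em : ExcludedMiddle 0ℓ) (ℝ : CompleteOrderedField) (T : TriangulatedSurface) where
  open CompleteOrderedField ℝ hiding (zero)
  open Analysis ℝ
  open OrderedField em ℝ
  open Calculus em ℝ
  open Integration em ℝ
  open DerivativeRules em ℝ
  open Triangle em ℝ
  open Sums em ℝ
  open Surface em ℝ T
  open SemiringSum semiring using (sum-cong-≋; sum-replicate; *-distribˡ-sum; *-distribʳ-sum; ∑-distrib-+)
  open TriangulatedSurface T
  open PolyhedralMetric ℝ T
  open SetoidReasoning setoid

  -- Continuity of the weights on nondegenerate metrics, formulated for an arbitrary filter so that
  -- it serves for left endpoints, right endpoints and tags alike.
  module WeightLimit {I : Set} (B : Carrier → I → Set)
    (B-mono : ∀ {δ ε} i → δ ≤ ε → B δ i → B ε i) where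
    open FilterLimits B B-mono

    module _ {U : I → Vector Carrier #edges} {u : Vector Carrier #edges}
      (ndU : ∀ i → Nondegenerate (U i)) (ndu : Nondegenerate u)
      (U⟶u : ∀ j → (λ i → U i j) ⟶ u j) where

      abstract
        area²-limit : ∀ f → (λ i → area² (U i) f) ⟶ area² u f
        area²-limit f = ⟶-- (⟶-- (⟶-* (⟶-+ b c) (⟶-+ b c)) (⟶-* (⟶-- b c) (⟶-- b c)))
                          (⟶-* (⟶-- (⟶-+ b c) a) (⟶-- (⟶-+ b c) a))
          where
          a : (λ i → sideValue (U i) f zero) ⟶ sideValue u f zero
          a = U⟶u _
          b : (λ i → sideValue (U i) f (suc zero)) ⟶ sideValue u f (suc zero)
          b = U⟶u _
          c : (λ i → sideValue (U i) f (suc (suc zero))) ⟶ sideValue u f (suc (suc zero))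
          c = U⟶u _

        cotOpposite-limit : ∀ s → (λ i → cotOpposite (U i) s) ⟶ cotOpposite u s
        cotOpposite-limit (f , k) = ⟶-cong (λ i → sym (cotOpposite≈ (ndU i) f k)) (sym (cotOpposite≈ ndu f k))
          (⟶-* (⟶-- (⟶-+ (U⟶u _) (U⟶u _)) (U⟶u _))
            (⟶-⁻¹ (λ i → 0<√ (0<area² (ndU i) f)) (0<√ (0<area² ndu f))
              (⟶-√ (λ i → 0<area² (ndU i) f) (0<area² ndu f) (area²-limit f))))

        weight-limit : ∀ j → (λ i → weight (U i) j) ⟶ weight u j
        weight-limit j = ⟶-cong (λ i → sym (weight≈ (U i) j)) (sym (weight≈ u j))
            (⟶-* (⟶-const ½) (overEdge (edgeType j)))
          where
          overEdge : ∀ {j} (e : EdgeType edge j) →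
            (λ i → sumOverEdge (cotOpposite (U i)) e) ⟶ sumOverEdge (cotOpposite u) e
          overEdge (boundary s _ _)         = cotOpposite-limit s
          overEdge (interior s t _ _ _ _ _) = ⟶-+ (cotOpposite-limit s) (cotOpposite-limit t)

  module _ (w̄ : Vector Carrier #edges) where

    gradient : Vector Carrier #edges → Vector Carrier #edges
    gradient u i = w̄ i - weight u i

    -- A primitive of the form Σᵢ (w̄ᵢ - wᵢ) duᵢ.
    potential : Vector Carrier #edges → Carrier
    potential u = sum (λ i → w̄ i * u i) - area u

    abstract
      potential-cong : ∀ {u v} → (∀ i → u i ≈ v i) → potential u ≈ potential v
      potential-cong u≈v = +-cong (sum-cong-≋ {#edges} (λ i → *-congˡ {w̄ i} (u≈v i))) (-‿cong (area-cong u≈v))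

      potential-convex : ∀ {u v} → Nondegenerate u → Nondegenerate v →
        sum (λ i → gradient u i * (v i - u i)) ≤ potential v - potential u
      potential-convex {u} {v} ndu ndv = ≤-by (x≤y⇒0≤y-x (area-concave ndu ndv)) (begin
          sum (λ i → weight u i * (v i - u i)) - (area v - area u)
            ≈⟨ solve 5 (λ S V U a b → S :- (a :- b) := ((V :- a) :- (U :- b)) :- ((V :- U) :- S)) refl
                 (sum (λ i → weight u i * (v i - u i))) (sum (λ i → w̄ i * v i)) (sum (λ i → w̄ i * u i))
                 (area v) (area u) ⟩
          potential v - potential u -
            ((sum (λ i → w̄ i * v i) - sum (λ i → w̄ i * u i)) - sum (λ i → weight u i * (v i - u i)))
            ≈⟨ +-congˡ (-‿cong (trans (+-congʳ (sum-- (λ i → w̄ i * v i) (λ i → w̄ i * u i)))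
                 (trans (sum-- (λ i → w̄ i * v i - w̄ i * u i) (λ i → weight u i * (v i - u i)))
                   (sum-cong-≋ {#edges} (λ i → solve 4 (λ w̄ w v u →
                     (w̄ :* v :- w̄ :* u) :- w :* (v :- u) := (w̄ :- w) :* (v :- u))
                     refl (w̄ i) (weight u i) (v i) (u i)))))) ⟩
          potential v - potential u - sum (λ i → gradient u i * (v i - u i)) ∎)

    module _ {p₀ q₀ : Vector Carrier #edges} (α : SmoothArc Admissible p₀ q₀) where
      open SmoothArc α

      private
        Φ integrand : Carrier → Carrier
        Φ t = potential (γ t)
        integrand t = sum λ i → gradient (γ t) i * γ′ t i

        nd : ∀ {t} → t ∈[ a , b ] → Nondegenerate (γ t)
        nd t∈ = admissible⇒nondegenerate (inside _ t∈)

        γ-cont : ∀ j → ContinuousOn a b (λ t → γ t j)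
        γ-cont j = differentiable⇒continuous (derivative j)

        module _ (t : Carrier) (t∈ : t ∈[ a , b ]) where
          open TaggedSubinterval
          open At a b t
          open WeightLimit Near Near-mono

          gradient-limit : (x : TaggedSubinterval a b → Carrier) → (∀ i → x i ∈[ a , b ]) →
            (∀ j → (λ i → γ (x i) j) ⟶ γ t j) → ∀ j → (λ i → gradient (γ (x i)) j) ⟶ gradient (γ t) j
          gradient-limit x x∈ γ⟶ j = ⟶-- (⟶-const (w̄ j)) (weight-limit (λ i → nd (x∈ i)) (nd t∈) γ⟶ j)

          γ-slope : ∀ j → slope (λ s → γ s j) ⟶ γ′ t j
          γ-slope j = strictly-differentiable (derivative j) (continuous-′ j) t∈

          sum-slope : ∀ (g : Vector Carrier #edges) i →
            sum (λ j → g j * (γ (r i) j - γ (q i) j)) * h i ⁻¹ ≈ sum (λ j → g j * slope (λ s → γ s j) i)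
          sum-slope g i = trans (*-distribʳ-sum (h i ⁻¹) (λ j → g j * (γ (r i) j - γ (q i) j)))
            (sum-cong-≋ {#edges} (λ j → *-assoc (g j) (γ (r i) j - γ (q i) j) (h i ⁻¹)))

          0≤h⁻¹ : ∀ (i : TaggedSubinterval a b) → 0# ≤ h i ⁻¹
          0≤h⁻¹ i = proj₁ (0<⁻¹ (0<h i))

          lower : ∀ i → sum (λ j → gradient (γ (q i)) j * slope (λ s → γ s j) i) ≤ slope Φ i
          lower i = ≤-respˡ-≈ (sum-slope (gradient (γ (q i))) i)
            (*-monoʳ-≤ (0≤h⁻¹ i) (potential-convex (nd (q∈ i)) (nd (r∈ i))))

          upper : ∀ i → slope Φ i ≤ sum (λ j → gradient (γ (r i)) j * slope (λ s → γ s j) i)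
          upper i = ≤-respʳ-≈ (sum-slope (gradient (γ (r i))) i)
            (*-monoʳ-≤ (0≤h⁻¹ i) (≤-by (x≤y⇒0≤y-x (potential-convex (nd (r∈ i)) (nd (q∈ i)))) (begin
              (Φ (q i) - Φ (r i)) - sum (λ j → gradient (γ (r i)) j * (γ (q i) j - γ (r i) j))
                ≈⟨ solve 3 (λ x y S → (x :- y) :- S := (:0 :- S) :- (y :- x))
                      refl (Φ (q i)) (Φ (r i)) _ ⟩
              (0# - sum (λ j → gradient (γ (r i)) j * (γ (q i) j - γ (r i) j))) - (Φ (r i) - Φ (q i))
                ≈⟨ +-congʳ (trans (+-congʳ (sym sum-zero)) (trans
                     (sum-- (λ _ → 0#) (λ j → gradient (γ (r i)) j * (γ (q i) j - γ (r i) j)))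
                     (sum-cong-≋ {#edges} (λ j → solve 3 (λ g x y → :0 :- g :* (x :- y) := g :* (y :- x)) refl
                        (gradient (γ (r i)) j) (γ (q i) j) (γ (r i) j))))) ⟩
              sum (λ j → gradient (γ (r i)) j * (γ (r i) j - γ (q i) j)) - (Φ (r i) - Φ (q i)) ∎)))
            where
            sum-zero : sum {#edges} (λ _ → 0#) ≈ 0#
            sum-zero = SemiringSum.sum-replicate-zero semiring #edges

          -- Riemann sums sample the tag and not `t`. The slope tends to `integrand t` by the
          -- squeeze, the value at the tag tends to the same limit by continuity, and so their
          -- difference is null.
          Φ-integrand : Null (λ i → slope Φ i - integrand (p i))
          Φ-integrand = null-cong
            (λ i → solve 3 (λ x y z → x :- y :- (z :- z) := x :- y)
                  refl (slope Φ i) (integrand (p i)) (integrand t))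
            (null (⟶--
              (⟶-squeeze lower upper
                (⟶-sum (λ j → ⟶-* (gradient-limit q q∈ (λ j → continuous-q (γ-cont j) t∈) j) (γ-slope j)))
                (⟶-sum (λ j → ⟶-* (gradient-limit r r∈ (λ j → continuous-r (γ-cont j) t∈) j) (γ-slope j))))
              (⟶-sum (λ j → ⟶-* (gradient-limit p p∈ (λ j → continuous-p (γ-cont j) t∈) j)
                                 (continuous-p (continuous-′ j) t∈)))))

      abstract
        arc-integral : HasIntegral a b integrand (Φ b - Φ a)
        arc-integral = fundamentalTheorem (proj₁ a<b)
          (λ x∈ y∈ x≈y → potential-cong (λ j → continuous⇒cong (γ-cont j) x∈ y∈ x≈y)) Φ-integrand

    line-integral : ∀ {x y} (π : PiecewiseSmoothPath Admissible x y) {J} →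
      J ≈ potential y - potential x → HasLineIntegral gradient π J
    line-integral ε J≈ = trans J≈ (-‿inverseʳ _)
    line-integral {x} {y} (_◅_ {j = z} α π) {J} J≈ = _ , _ , arc-integral α , line-integral π refl , (begin
      J                                          ≈⟨ J≈ ⟩
      potential y - potential x
        ≈⟨ solve 3 (λ x y z → y :- x := (z :- x) :+ (y :- z))
            refl (potential x) (potential y) (potential z) ⟩
      (potential z - potential x) + (potential y - potential z)
        -- Arcs meet their prescribed endpoints only up to `≈`.
        ≈⟨ +-congʳ (+-cong (potential-cong (λ j → sym (target j))) (-‿cong (potential-cong (λ j → sym (source j))))) ⟩
      (potential (γ b) - potential (γ a)) + (potential y - potential z) ∎)
      where open SmoothArc α

  abstract
    -- The expansion of a quadratic form between two points: 3 and a + b + c are the values at (1,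
    -- 1, 1) of the form and of its pairing with (a, b, c). All three coefficients are positive for
    -- a nondegenerate face.
    heron-segment : ∀ t a b c → heron (1# + t * (a - 1#)) (1# + t * (b - 1#)) (1# + t * (c - 1#)) ≈
      (1# - t) * (1# - t) * (1# + 1# + 1#) + (2# * (t * (1# - t)) * (a + b + c) + t * t * heron a b c)
    heron-segment = solve 4 (λ t a b c →
      let x = :1 :+ t :* (a :- :1) ; y = :1 :+ t :* (b :- :1) ; z = :1 :+ t :* (c :- :1) in
      (y :+ z) :* (y :+ z) :- (y :- z) :* (y :- z) :- (y :+ z :- x) :* (y :+ z :- x) :=
      (:1 :- t) :* (:1 :- t) :* (:1 :+ :1 :+ :1) :+ (:2 :* (t :* (:1 :- t)) :* (a :+ b :+ c) :+
        t :* t :* ((b :+ c) :* (b :+ c) :- (b :- c) :* (b :- c) :- (b :+ c :- a) :* (b :+ c :- a)))) refl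

  module _ {u : Vector Carrier #edges} (adm : Admissible u) where
    private
      segment : Carrier → Vector Carrier #edges
      segment t i = 1# + t * (u i - 1#)

      ndu : Nondegenerate u
      ndu = admissible⇒nondegenerate adm

      module _ {t : Carrier} (t∈ : t ∈[ 0# , 1# ]) where
        0≤t : 0# ≤ t
        0≤t = proj₁ t∈
        0≤1-t : 0# ≤ 1# - t
        0≤1-t = x≤y⇒0≤y-x (proj₂ t∈)

        -- t and 1 - t do not vanish simultaneously.
        0<combination : ∀ {x y z} → 0# < x → 0# ≤ y → 0# < z →
          0# < (1# - t) * (1# - t) * x + (y + t * t * z)
        0<combination {x} {y} {z} 0<x 0≤y 0<z with em {0# ≈ t}
        ... | no 0≉t = <-respʳ-≈ (+-comm _ _) (0<+ (<-respʳ-≈ (+-comm _ _)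
                (0<+ (0<* (0<* (0≤t , 0≉t) (0≤t , 0≉t)) 0<z) 0≤y)) (*-nonneg (*-nonneg 0≤1-t 0≤1-t) (proj₁ 0<x)))
        ... | yes 0≈t = 0<+ (0<* (0<* 0<1-t 0<1-t) 0<x) (0≤+ 0≤y (*-nonneg (*-nonneg 0≤t 0≤t) (proj₁ 0<z)))
          where
          0<1-t : 0# < 1# - t
          0<1-t = <-respʳ-≈ (trans (solve 0 (:1 := :1 :- :0) refl) (+-congˡ (-‿cong 0≈t))) 0<1

        segment-positive : ∀ i → 0# < segment t i
        -- Multiplying (1 - t) + tu by (1 - t) + t = 1 brings this linear expression into the
        -- quadratic shape of `0<combination`.
        segment-positive i = <-respʳ-≈
          (solve 2 (λ t u → (:1 :- t) :* (:1 :- t) :* :1 :+ ((t :* (:1 :- t)) :* (u :+ :1) :+ t :* t :* u) :=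
                           :1 :+ t :* (u :- :1))
                refl t (u i))
          (0<combination 0<1 (*-nonneg (*-nonneg 0≤t 0≤1-t) (0≤+ (proj₁ (positive ndu i)) 0≤1)) (positive ndu i))

        segment-area² : ∀ f → 0# < area² (segment t) f
        segment-area² f = <-respʳ-≈ (sym (heron-segment t _ _ _))
          (0<combination (0<+ 0<2 0≤1)
            (*-nonneg (*-nonneg (proj₁ 0<2) (*-nonneg 0≤t 0≤1-t))
              (0≤+ (0≤+ (proj₁ (positive ndu _)) (proj₁ (positive ndu _))) (proj₁ (positive ndu _))))
            (0<area² ndu f))

        segment-admissible : Admissible (segment t)
        segment-admissible = record
          { positive   = segment-positive
          ; normalised = begin
              sum (λ i → 1# + t * (u i - 1#))
                ≈⟨ ∑-distrib-+ (λ _ → 1#) (λ i → t * (u i - 1#)) ⟩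
              sum {#edges} (λ _ → 1#) + sum (λ i → t * (u i - 1#))
                ≈⟨ +-congˡ (*-distribˡ-sum t (λ i → u i - 1#)) ⟨
              sum {#edges} (λ _ → 1#) + t * sum (λ i → u i - 1#)
                ≈⟨ +-congˡ (*-congˡ (sum-- u (λ _ → 1#))) ⟨
              sum {#edges} (λ _ → 1#) + t * (sum u - sum {#edges} (λ _ → 1#))
                ≈⟨ +-cong (sum-replicate #edges) (*-congˡ
                     (+-cong (Admissible.normalised adm) (-‿cong (sum-replicate #edges)))) ⟩
              #edges · 1# + t * (#edges · 1# - #edges · 1#)
                ≈⟨ solve 2 (λ m t → m :+ t :* (m :- m) := m) refl (#edges · 1#) t ⟩
              #edges · 1# ∎
          ; triangle   = λ f k → triangle-heron (segment-positive _) (segment-positive _) (segment-positive _)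
              (<-respʳ-≈ (sym (rotated≈ (segment t) f k)) (segment-area² f))
          }

    path : PiecewiseSmoothPath Admissible (replicate #edges 1#) u
    path = record
      { a = 0# ; b = 1# ; a<b = 0<1
      ; γ = segment
      ; γ′ = λ _ i → u i - 1#
      ; derivative = λ i → affine-derivative 1# (u i - 1#)
      ; continuous-′ = λ i → const-continuous (u i - 1#)
      ; inside = λ t t∈ → segment-admissible t∈
      ; source = λ i → solve 1 (λ u → :1 :+ :0 :* (u :- :1) := :1) refl (u i)
      ; target = λ i → solve 1 (λ u → :1 :+ :1 :* (u :- :1) := u) refl (u i)
      } ◅ ε

  module _ (connected : Connected T) {w̄ ū : Vector Carrier #edges}
    (admū : Admissible ū) (weight≈w̄ : ∀ i → weight ū i ≈ w̄ i) where

    private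
      ndū : Nondegenerate ū
      ndū = admissible⇒nondegenerate admū

      P : Vector Carrier #edges → Carrier
      P = potential w̄

    abstract
      potential≈ : ∀ u → P u ≈ sum (λ i → weight ū i * u i) - area u
      potential≈ u = +-congʳ (sum-cong-≋ {#edges} (λ i → *-congʳ {u i} (sym (weight≈w̄ i))))

      -- By Euler's identity the linear part at `ū` equals the area there. With the minimal value
      -- known to be zero, minimality is `area-≤` itself.
      potential-ū≈0 : P ū ≈ 0#
      potential-ū≈0 = trans (potential≈ ū) (trans (+-congˡ (-‿cong (area-≈ ndū))) (-‿inverseʳ _))

      potential-minimal : ∀ {v} → Admissible v → P ū ≤ P v
      potential-minimal {v} admv = ≤-respˡ-≈ (sym potential-ū≈0) (≤-respʳ-≈ (sym (potential≈ v))
        (x≤y⇒0≤y-x (area-≤ ndū (admissible⇒nondegenerate admv))))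

      module Minimizer {u} (admu : Admissible u) (Pu≤Pū : P u ≤ P ū) where
        ndu : Nondegenerate u
        ndu = admissible⇒nondegenerate admu

        sum-weight≤area : sum (λ i → weight ū i * u i) ≤ area u
        sum-weight≤area = x-y≤0⇒x≤y (≤-respˡ-≈ (potential≈ u) (≤-respʳ-≈ potential-ū≈0 Pu≤Pū))

        sum-faceSum≤ : sum (faceSum ū u) ≤ sum (λ f → √ (area² u f))
        sum-faceSum≤ = *-cancelˡ-≤ 0<½ (≤-respˡ-≈ (sum-weight ū u) sum-weight≤area)

        -- A potential at `u` no greater than that at `ū` reverses the summed tangent plane
        -- inequality, which leaves no slack on any single face.
        faces-equal : ∀ f → √ (area² u f) ≈ faceSum ū u f
        faces-equal = sum-equal {#faces} {λ f → √ (area² u f)} {faceSum ū u}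
          (area≤faceSum {ū} {u} ndū ndu) sum-faceSum≤

        ratio : Fin #faces → Carrier
        ratio f = proj₁ (proportional {ū} {u} ndū ndu f (faces-equal f))

        ratio-* : ∀ f k → u (edge (f , k)) ≈ ratio f * ū (edge (f , k))
        ratio-* f = proj₂ (proportional {ū} {u} ndū ndu f (faces-equal f))

        -- Both ratios multiply the same positive value of `ū` on the common edge to the same value
        -- of `u`.
        ratio-adjacent : ∀ {f g} → Adjacent f g → ratio f ≈ ratio g
        ratio-adjacent {f} {g} (k , l , same) = *-cancelˡ-≈ (0<⇒≉0 (positive ndū (edge (g , l)))) (begin
          ū (edge (g , l)) * ratio f  ≈⟨ *-comm _ _ ⟩
          ratio f * ū (edge (g , l))  ≈⟨ ≡.subst (λ e → ratio f * ū e ≈ u e) same (sym (ratio-* f k)) ⟩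
          u (edge (g , l))            ≈⟨ ratio-* g l ⟩
          ratio g * ū (edge (g , l))  ≈⟨ *-comm _ _ ⟩
          ū (edge (g , l)) * ratio g  ∎)

        ratio-constant : ∀ {f g} → Star Adjacent f g → ratio f ≈ ratio g
        ratio-constant ε       = refl
        ratio-constant (e ◅ π) = trans (ratio-adjacent e) (ratio-constant π)

        side-of : ∀ i → ∃ λ s → edge s ≡ i
        side-of i with edgeType i
        ... | boundary s es≡i _           = s , es≡i
        ... | interior s _ _ es≡i _ _ _   = s , es≡i

        scaled : ∀ f i → u i ≈ ratio f * ū i
        scaled f i = let (g , k) , same = side-of i in
          ≡.subst (λ e → u e ≈ ratio f * ū e) same
            (trans (ratio-* g k) (*-congʳ {ū (edge (g , k))} (ratio-constant (connected g f))))

        ratio≈1 : ∀ f → ratio f ≈ 1#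
        -- The face `f` supplies an edge, so `sum ū` is not an empty sum and can be cancelled.
        ratio≈1 f = *-cancelˡ-≈ (0<⇒≉0 (0<sum (edge (f , zero)) (positive ndū))) (begin
          sum ū * ratio f            ≈⟨ *-comm _ _ ⟩
          ratio f * sum ū            ≈⟨ *-distribˡ-sum (ratio f) ū ⟩
          sum (λ i → ratio f * ū i)  ≈⟨ sum-cong-≋ {#edges} (λ i → sym (scaled f i)) ⟩
          sum u                      ≈⟨ Admissible.normalised admu ⟩
          #edges · 1#                ≈⟨ Admissible.normalised admū ⟨
          sum ū                      ≈⟨ *-identityʳ _ ⟨
          sum ū * 1#                 ∎)

        someFace : ∀ {n} → ℕ.NonZero n → Fin n
        someFace {ℕ.suc n} _ = zero

        u≈ū : ∀ i → u i ≈ ū i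
        u≈ū i = trans (scaled (someFace nonEmpty) i)
          (trans (*-congʳ (ratio≈1 (someFace nonEmpty))) (*-identityˡ _))

theorem5 : ExcludedMiddle 0ℓ →
    (ℝ : CompleteOrderedField) (T : TriangulatedSurface) → Connected T →
    let open CompleteOrderedField ℝ
        open TriangulatedSurface T
        open Analysis ℝ
        open PolyhedralMetric ℝ T
    in
    (w̄ ū : Vector Carrier #edges) →
    Admissible ū →
    (∀ i → weight ū i ≈ w̄ i) →
    ∃ λ E → IsEnergy w̄ E × IsUniqueGlobalMinimizer Admissible E ū
theorem5 em ℝ T connected w̄ ū admū weight≈w̄ =
  -- The integral starts at (1, ..., 1), which fixes the additive constant; it cancels whenever two
  -- energies are compared.
  (λ u → potential w̄ u - potential w̄ (replicate #edges 1#)) ,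
  (λ u admu → path admu , λ π → line-integral w̄ π refl) ,
  (admū , λ v admv → +-monoˡ-≤ _ (potential-minimal connected admū weight≈w̄ admv)) ,
  λ u (admu , minimal) → Minimizer.u≈ū connected admū weight≈w̄ admu
    (≤-by (x≤y⇒0≤y-x (minimal ū admū))
      (solve 3 (λ x y z → (x :- z) :- (y :- z) := x :- y) refl
        (potential w̄ ū) (potential w̄ u) (potential w̄ (replicate #edges 1#))))
  where
  open CompleteOrderedField ℝ
  open OrderedField em ℝ
  open TriangulatedSurface T
  open Energy em ℝ T
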